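{- Let $G$ be a graph consisting of $p$ internally disjoint paths between two vertices $u$ and $v$ (all other vertices having degree $2$), drawn in the plane without crossings with $u$ the leftmost and $v$ the rightmost vertex, such that the drawing is symmetric under reflection in a vertical line (which interchanges $u$ and $v$ and maps each of the $p$ paths to itself). Suppose every one of the $p$ paths having an odd number of edges has at least $5$ edges. Then in the Game of Cycles on $G$, Player 1 has a winning strategy when $G$ has an odd number of edges, and Player 2 has a winning strategy when $G$ has an even number of edges.
   Context: Game of Cycles: the gameboard is a simple connected graph drawn in the plane without crossings. Players 1 and 2 alternate turns, Player 1 first; on a turn a player must, if possible, direct one currently undirected edge, and it is illegal to create a sink (a vertex all of whose incident edges point into it) or a source (a vertex all of whose incident edges point out of it). A cycle cell is a cycle of the graph bounding a bounded face of the drawing (here, the cycle formed by two paths that are consecutive in the drawing); a player who directs an edge so that all edges of some cycle cell are directed consistently around it wins immediately. Otherwise the player who makes the last legal move wins. -}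

module Defs where

open import Data.Nat using (ℕ; zero; suc; _≤_; _<_)
open import Data.Nat.DivMod using (_%_)
open import Data.Fin using (Fin; toℕ; _≟_)
open import Data.List using (List; tabulate)
open import Data.Nat.ListAction using (sum)
open import Data.Maybe using (Maybe; just; nothing)
open import Data.Product using (Σ; _×_; _,_)
open import Data.Sum using (_⊎_)
open import Relation.Nullary using (¬_; yes; no)
open import Relation.Binary.PropositionalEquality using (_≡_; refl)

Odd : ℕ → Set
Odd n = n % 2 ≡ 1

-- Orientation of an edge of a path: fwd = pointing from u towards v.
data Dir : Set where
  fwd bwd : Dir

-- The theta-type graph: p paths from u to v, path i has len i edges.
-- Path i has vertices u = x_0, x_1, ..., x_{len i} = v, and its edge j
-- (j : Fin (len i)) joins x_j and x_{j+1}. Paths are listed in the order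
-- in which they appear (top to bottom) in the planar drawing.
module ThetaGame (p : ℕ) (len : Fin p → ℕ) where

  State : Set
  State = (i : Fin p) → Fin (len i) → Maybe Dir

  initial : State
  initial _ _ = nothing

  numEdges : ℕ
  numEdges = sum (tabulate len)

  update : State → (i : Fin p) → Fin (len i) → Dir → State
  update s i j d i' j' with i' ≟ i
  ... | no _ = s i' j'
  ... | yes refl with j' ≟ j
  ...   | yes _ = just d
  ...   | no _  = s i' j'

  USink : State → Set
  USink s = (i : Fin p) (j : Fin (len i)) → toℕ j ≡ 0 → s i j ≡ just bwd

  USource : State → Set
  USource s = (i : Fin p) (j : Fin (len i)) → toℕ j ≡ 0 → s i j ≡ just fwd

  VSink : State → Set
  VSink s = (i : Fin p) (j : Fin (len i)) → suc (toℕ j) ≡ len i → s i j ≡ just fwd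

  VSource : State → Set
  VSource s = (i : Fin p) (j : Fin (len i)) → suc (toℕ j) ≡ len i → s i j ≡ just bwd

  InternalSinkOrSource : State → Set
  InternalSinkOrSource s =
    Σ (Fin p) λ i → Σ (Fin (len i)) λ j → Σ (Fin (len i)) λ j' →
      (suc (toℕ j) ≡ toℕ j') ×
      ((s i j ≡ just fwd × s i j' ≡ just bwd) ⊎ (s i j ≡ just bwd × s i j' ≡ just fwd))

  Legal : State → Set
  Legal s = ¬ USink s × ¬ USource s × ¬ VSink s × ¬ VSource s × ¬ InternalSinkOrSource s

  -- cycle cells: cycles formed by paths i and i' consecutive in the drawing;
  -- directed consistently around = one path all fwd, the other all bwd
  CellComplete : State → Set
  CellComplete s =
    Σ (Fin p) λ i → Σ (Fin p) λ i' → (suc (toℕ i) ≡ toℕ i') ×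
      ((((j : Fin (len i)) → s i j ≡ just fwd) × ((j : Fin (len i')) → s i' j ≡ just bwd)) ⊎
       (((j : Fin (len i)) → s i j ≡ just bwd) × ((j : Fin (len i')) → s i' j ≡ just fwd)))

  -- Win s : the player to move in position s has a winning strategy.
  -- Lose s : the player to move in position s loses against best play
  --          (i.e. the other player has a winning strategy).
  data Win (s : State) : Set
  data Lose (s : State) : Set

  data Win s where
    win : (i : Fin p) (j : Fin (len i)) (d : Dir) →
          s i j ≡ nothing →
          Legal (update s i j d) →
          CellComplete (update s i j d) ⊎ Lose (update s i j d) →
          Win s

  data Lose s where
    lose : ((i : Fin p) (j : Fin (len i)) (d : Dir) →
            s i j ≡ nothing →
            Legal (update s i j d) →
            ¬ CellComplete (update s i j d) × Win (update s i j d)) →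
           Lose s

{-# OPTIONS --safe #-}

-- Let j ↦ opposite j be the reflection of a path; a move is mirrored with the same direction along
-- the path.  The player who wins keeps a symmetric legal orientation t that extends the position,
-- with an even number of free centre edges (opening with a centre if there are oddly many), and
-- answers so that no path ever lacks exactly one edge: then the opponent cannot complete a cell.
-- Moves away from the centre are mirrored, and a centre is answered by another centre.  If mirroring
-- would leave only the centre of a path free, a centre elsewhere is played instead; the two edges
-- left on that path are then forced (this uses five edges), they count as played in t, and they
-- answer each other.
--
-- The mirrored orientation can be illegal only because t makes all ends at u and v point the same way
-- d along their paths.  Then no cell can be completed any more, and the parity of the number of
-- remaining moves is determined by the ends of the paths, whatever is played.
module Submission where

open import Defs
open import Data.Nat using (ℕ; zero; suc; _+_; _*_; _≤_; _<_; z≤n; s≤s)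
open import Data.Nat.DivMod using (_%_; m%n<n)
open import Data.Nat.Divisibility using (_∣_; divides; _∣0; ∣1⇒≡1; ∣m∣n⇒∣m+n; ∣m+n∣m⇒∣n; m%n≡0⇒n∣m; n∣m⇒m%n≡0; ∣-refl)
open import Data.Nat.ListAction using (sum)
import Data.Nat as ℕ
import Data.Nat.Properties as ℕₚ
open import Data.Fin using (Fin; zero; suc; toℕ; fromℕ<; opposite; _≟_)
open import Data.Fin.Properties
  using (toℕ-injective; toℕ-fromℕ<; toℕ<n; opposite-prop; opposite-involutive; any?; all?; ¬∀⟶∃¬; suc-injective)
open import Data.List using (tabulate)
open import Data.Maybe using (Maybe; just; nothing)
open import Data.Maybe.Properties using (just-injective)
open import Data.Product using (Σ; ∃; _×_; _,_; proj₁; proj₂; ∃₂)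
open import Data.Sum using (_⊎_; inj₁; inj₂; swap; [_,_]′; map₁; map₂)
open import Data.Empty using (⊥)
open import Function using (_∘_; case_of_)
open import Relation.Binary.Definitions using (tri<; tri≈; tri>)
open import Relation.Nullary using (¬_; Dec; yes; no; contradiction; ¬?)
open import Relation.Nullary.Decidable using (_×-dec_; _⊎-dec_; map′)
open import Relation.Binary.PropositionalEquality
  using (_≡_; _≢_; refl; sym; trans; cong; cong₂; subst; module ≡-Reasoning)

private variable n : ℕ

-- Parity and finite sums

even-suc-suc : ∀ {m} → 2 ∣ m → 2 ∣ suc (suc m)
even-suc-suc = ∣m∣n⇒∣m+n ∣-refl

not-both-even : ∀ {m} → 2 ∣ m → ¬ 2 ∣ suc m
not-both-even {m} 2∣m 2∣sm =
  case ∣1⇒≡1 (∣m+n∣m⇒∣n (subst (2 ∣_) (ℕₚ.+-comm 1 m) 2∣sm) 2∣m) of λ ()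

even-or-suc-even : ∀ m → 2 ∣ m ⊎ 2 ∣ suc m
even-or-suc-even zero = inj₁ (2 ∣0)
even-or-suc-even (suc m) = swap (map₁ even-suc-suc (even-or-suc-even m))

suc-even⇒Odd : ∀ m → 2 ∣ suc m → Odd m
suc-even⇒Odd m 2∣sm with m % 2 in eq | m%n<n m 2
... | 0 | _ = contradiction 2∣sm (not-both-even (m%n≡0⇒n∣m m 2 eq))
... | 1 | _ = refl
... | suc (suc _) | s≤s (s≤s ())

Odd⇒suc-even : ∀ m → Odd m → 2 ∣ suc m
Odd⇒suc-even m odd with even-or-suc-even m
... | inj₂ 2∣sm = 2∣sm
... | inj₁ 2∣m = case trans (sym odd) (n∣m⇒m%n≡0 m 2 2∣m) of λ ()

total : (Fin n → ℕ) → ℕ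
total f = sum (tabulate f)

total-cong : {f g : Fin n → ℕ} → (∀ i → f i ≡ g i) → total f ≡ total g
total-cong {zero} f≗g = refl
total-cong {suc n} f≗g = cong₂ _+_ (f≗g zero) (total-cong (f≗g ∘ suc))

total-zero : total {n} (λ _ → 0) ≡ 0
total-zero {zero} = refl
total-zero {suc n} = total-zero {n}

total-one : total {n} (λ _ → 1) ≡ n
total-one {zero} = refl
total-one {suc n} = cong suc total-one

total-step : {f g : Fin n → ℕ} (i : Fin n) → f i ≡ suc (g i) →
             (∀ j → j ≢ i → f j ≡ g j) → total f ≡ suc (total g)
total-step zero fi others =
  cong₂ _+_ fi (total-cong (λ j → others (suc j) λ ()))
total-step {g = g} (suc i) fi others =
  trans (cong₂ _+_ (others zero λ ())
                   (total-step i fi (λ j j≢i → others (suc j) (j≢i ∘ suc-injective))))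
        (ℕₚ.+-suc (g zero) _)

total-even : {f : Fin n → ℕ} → (∀ i → 2 ∣ f i) → 2 ∣ total f
total-even {zero} even = 2 ∣0
total-even {suc n} even = ∣m∣n⇒∣m+n (even zero) (total-even (even ∘ suc))

total-odd : {f : Fin n → ℕ} (i : Fin n) → 2 ∣ suc (f i) →
            (∀ j → j ≢ i → 2 ∣ f j) → 2 ∣ suc (total f)
total-odd zero odd even = ∣m∣n⇒∣m+n odd (total-even (λ j → even (suc j) λ ()))
total-odd {f = f} (suc i) odd even =
  subst (2 ∣_) (ℕₚ.+-suc (f zero) _)
    (∣m∣n⇒∣m+n (even zero λ ())
               (total-odd i odd (λ j j≢i → even (suc j) (j≢i ∘ suc-injective))))

-- `2 ∣ f i + g i` encodes equal parity, so the two sums can be merged term by term without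
-- splitting on parities.
total-same-parity : {f g : Fin n → ℕ} → (∀ i → 2 ∣ f i + g i) → 2 ∣ total f + total g
total-same-parity {zero} even = 2 ∣0
total-same-parity {suc n} {f} {g} even =
  subst (2 ∣_) (interchange (f zero) (g zero) _ _)
    (∣m∣n⇒∣m+n (even zero) (total-same-parity (even ∘ suc)))
  where
  interchange : ∀ a b c d → (a + b) + (c + d) ≡ (a + c) + (b + d)
  interchange a b c d = begin
    (a + b) + (c + d) ≡⟨ ℕₚ.+-assoc a b (c + d) ⟩
    a + (b + (c + d)) ≡⟨ cong (a +_) (ℕₚ.+-assoc b c d) ⟨
    a + ((b + c) + d) ≡⟨ cong (λ x → a + (x + d)) (ℕₚ.+-comm b c) ⟩
    a + ((c + b) + d) ≡⟨ cong (a +_) (ℕₚ.+-assoc c b d) ⟩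
    a + (c + (b + d)) ≡⟨ ℕₚ.+-assoc a c (b + d) ⟨
    (a + c) + (b + d) ∎
    where open ≡-Reasoning

total-nonzero : {f : Fin n → ℕ} → total f ≢ 0 → ∃ λ i → f i ≢ 0
total-nonzero {zero} ≢0 = contradiction refl ≢0
total-nonzero {suc n} {f} ≢0 with f zero in eq
... | suc _ = zero , λ f0≡0 → case trans (sym eq) f0≡0 of λ ()
... | zero with total-nonzero ≢0
...   | i , fi≢0 = suc i , fi≢0

-- Finite search: below, `A` is the existence of a legal move, and `B i` is what its absence says
-- about path `i`.
all-unless : {A : Set} {B : Fin n → Set} → (∀ i → A ⊎ B i) → A ⊎ (∀ i → B i)
all-unless {zero} f = inj₂ λ ()
all-unless {suc n} f with f zero | all-unless (f ∘ suc)
... | inj₁ a | _ = inj₁ a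
... | inj₂ _ | inj₁ a = inj₁ a
... | inj₂ b | inj₂ bs = inj₂ λ { zero → b ; (suc i) → bs i }

-- Directions

flip : Dir → Dir
flip fwd = bwd
flip bwd = fwd

flip-≢ : ∀ d → flip d ≢ d
flip-≢ fwd ()
flip-≢ bwd ()

≢⇒flip : ∀ {d d'} → d ≢ d' → d ≡ flip d'
≢⇒flip {fwd} {fwd} d≢d' = contradiction refl d≢d'
≢⇒flip {fwd} {bwd} d≢d' = refl
≢⇒flip {bwd} {fwd} d≢d' = refl
≢⇒flip {bwd} {bwd} d≢d' = contradiction refl d≢d'

_≟ᴰ_ : (d d' : Dir) → Dec (d ≡ d')
fwd ≟ᴰ fwd = yes refl
fwd ≟ᴰ bwd = no λ ()
bwd ≟ᴰ fwd = no λ ()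
bwd ≟ᴰ bwd = yes refl

_≟ᴹ_ : (x y : Maybe Dir) → Dec (x ≡ y)
nothing ≟ᴹ nothing = yes refl
nothing ≟ᴹ just _ = no λ ()
just _ ≟ᴹ nothing = no λ ()
just d ≟ᴹ just d' = map′ (cong just) just-injective (d ≟ᴰ d')

nothing≢just : {x : Maybe Dir} {d : Dir} → x ≡ nothing → x ≢ just d
nothing≢just refl ()

marked-or-free : (x : Maybe Dir) → (∃ λ d → x ≡ just d) ⊎ x ≡ nothing
marked-or-free (just d) = inj₁ (d , refl)
marked-or-free nothing = inj₂ refl

free : Maybe Dir → ℕ
free nothing = 1
free (just _) = 0

-- Positions on a path with n edges

toℕ-opposite : (j : Fin n) → toℕ (opposite j) + suc (toℕ j) ≡ n
toℕ-opposite j = trans (cong (_+ suc (toℕ j)) (opposite-prop j)) (ℕₚ.m∸n+n≡m (toℕ<n j))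

Adj : (j k : Fin n) → Set
Adj j k = suc (toℕ j) ≡ toℕ k ⊎ suc (toℕ k) ≡ toℕ j

suc-opposite : {j k : Fin n} → suc (toℕ j) ≡ toℕ k → suc (toℕ (opposite k)) ≡ toℕ (opposite j)
suc-opposite {j = j} {k} sj≡k = ℕₚ.+-cancelʳ-≡ (suc (toℕ j)) _ _ (begin
  suc (toℕ (opposite k)) + suc (toℕ j) ≡⟨ ℕₚ.+-suc (toℕ (opposite k)) _ ⟨
  toℕ (opposite k) + suc (suc (toℕ j)) ≡⟨ cong (λ x → toℕ (opposite k) + suc x) sj≡k ⟩
  toℕ (opposite k) + suc (toℕ k)       ≡⟨ toℕ-opposite k ⟩
  _                                    ≡⟨ toℕ-opposite j ⟨
  toℕ (opposite j) + suc (toℕ j)       ∎)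
  where open ≡-Reasoning

Adj-opposite : {j k : Fin n} → Adj j k → Adj (opposite j) (opposite k)
Adj-opposite (inj₁ eq) = inj₂ (suc-opposite eq)
Adj-opposite (inj₂ eq) = inj₁ (suc-opposite eq)

Adj-irrefl : {j : Fin n} → ¬ Adj j j
Adj-irrefl (inj₁ eq) = ℕₚ.1+n≢n eq
Adj-irrefl (inj₂ eq) = ℕₚ.1+n≢n eq

opposite-swap : {j k : Fin n} → opposite j ≡ k → j ≡ opposite k
opposite-swap {j = j} refl = sym (opposite-involutive j)

Centre : Fin n → Set
Centre c = opposite c ≡ c

Centre? : (c : Fin n) → Dec (Centre c)
Centre? c = opposite c ≟ c

centre-toℕ : {c : Fin n} → Centre c → toℕ c + suc (toℕ c) ≡ n
centre-toℕ {c = c} ctr = subst (λ x → toℕ x + suc (toℕ c) ≡ _) ctr (toℕ-opposite c)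

toℕ-centre : {c : Fin n} → toℕ c + suc (toℕ c) ≡ n → Centre c
toℕ-centre {c = c} eq =
  toℕ-injective (ℕₚ.+-cancelʳ-≡ (suc (toℕ c)) _ _ (trans (toℕ-opposite c) (sym eq)))

-- By `centre-toℕ` a centre at position `a` gives `n = a + suc a`; injectivity makes the centre
-- unique.
double-injective : ∀ a b → a + suc a ≡ b + suc b → a ≡ b
double-injective zero zero eq = refl
double-injective (suc a) (suc b) eq = cong suc (double-injective a b
  (ℕₚ.suc-injective (ℕₚ.suc-injective
    (trans (cong suc (sym (ℕₚ.+-suc a (suc a)))) (trans eq (cong suc (ℕₚ.+-suc b (suc b))))))))
double-injective zero (suc b) eq =
  case trans eq (cong suc (ℕₚ.+-suc b (suc b))) of λ ()
double-injective (suc a) zero eq =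
  case trans (sym eq) (cong suc (ℕₚ.+-suc a (suc a))) of λ ()

centre-unique : {c c' : Fin n} → Centre c → Centre c' → c ≡ c'
centre-unique {c = c} {c'} ctr ctr' = toℕ-injective
  (double-injective (toℕ c) (toℕ c') (trans (centre-toℕ ctr) (sym (centre-toℕ ctr'))))

centre⇒odd : {c : Fin n} → Centre c → 2 ∣ suc n
centre⇒odd {n} {c} ctr = divides (suc (toℕ c)) (begin
  suc n                       ≡⟨ cong suc (centre-toℕ ctr) ⟨
  suc (toℕ c) + suc (toℕ c)   ≡⟨ cong (suc (toℕ c) +_) (ℕₚ.+-identityʳ _) ⟨
  2 * suc (toℕ c)             ≡⟨ ℕₚ.*-comm 2 (suc (toℕ c)) ⟩
  suc (toℕ c) * 2             ∎)
  where open ≡-Reasoning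

odd⇒centre : 2 ∣ suc n → ∃ λ (c : Fin n) → Centre c
-- Here `suc n` is `suc k * 2`, so `n = k + suc k` and the middle edge has index `k`.
odd⇒centre {n} (divides (suc k) eq) = fromℕ< k<n , toℕ-centre (begin
    toℕ (fromℕ< k<n) + suc (toℕ (fromℕ< k<n)) ≡⟨ cong (λ x → x + suc x) (toℕ-fromℕ< k<n) ⟩
    k + suc k ≡⟨ n≡k+sk ⟨
    n ∎)
  where
  open ≡-Reasoning
  n≡k+sk : n ≡ k + suc k
  n≡k+sk = begin
    n             ≡⟨ ℕₚ.suc-injective eq ⟩
    suc (k * 2)   ≡⟨ cong suc (ℕₚ.*-comm k 2) ⟩
    suc (k + (k + 0)) ≡⟨ cong (λ x → suc (k + x)) (ℕₚ.+-identityʳ k) ⟩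
    suc (k + k)   ≡⟨ ℕₚ.+-suc k k ⟨
    k + suc k     ∎
  k<n : k < n
  k<n = subst (k <_) (sym n≡k+sk) (ℕₚ.m≤n+m (suc k) k)

data Side : Set where
  U V : Side

other : Side → Side
other U = V
other V = U

other-involutive : ∀ σ → other (other σ) ≡ σ
other-involutive U = refl
other-involutive V = refl

IsEnd : Side → Fin n → Set
IsEnd U j = toℕ j ≡ 0
IsEnd {n} V j = suc (toℕ j) ≡ n

IsEnd? : ∀ σ (j : Fin n) → Dec (IsEnd σ j)
IsEnd? U j = toℕ j ℕ.≟ 0
IsEnd? V j = suc (toℕ j) ℕ.≟ _

end-unique : ∀ σ {j k : Fin n} → IsEnd σ j → IsEnd σ k → j ≡ k
end-unique U p q = toℕ-injective (trans p (sym q))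
end-unique V p q = toℕ-injective (ℕₚ.suc-injective (trans p (sym q)))

end-opposite : ∀ σ {j : Fin n} → IsEnd σ j → IsEnd (other σ) (opposite j)
end-opposite U {j} j≡0 = trans (ℕₚ.+-comm 1 _)
  (subst (λ x → toℕ (opposite j) + suc x ≡ _) j≡0 (toℕ-opposite j))
end-opposite {n} V {j} sj≡n = ℕₚ.+-cancelʳ-≡ n _ _
  (subst (λ x → toℕ (opposite j) + x ≡ n) sj≡n (toℕ-opposite j))

end-opposite⁻ : ∀ σ {j : Fin n} → IsEnd σ (opposite j) → IsEnd (other σ) j
end-opposite⁻ σ {j} e = subst (IsEnd (other σ)) (opposite-involutive j) (end-opposite σ e)

ends-distinct : 2 ≤ n → ∀ σ {j : Fin n} → IsEnd σ j → ¬ IsEnd (other σ) j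
ends-distinct 2≤n U p q with subst (λ x → suc x ≡ _) p q
ends-distinct (s≤s ()) U p q | refl
ends-distinct 2≤n V p q = ends-distinct 2≤n U q p

end-exists : 1 ≤ n → ∀ σ → ∃ λ (j : Fin n) → IsEnd σ j
end-exists (s≤s _) U = zero , refl
end-exists (s≤s _) V = opposite zero , end-opposite U refl

end-neighbour-unique : ∀ σ {j k l : Fin n} → IsEnd σ j → Adj j k → Adj j l → k ≡ l
end-neighbour-unique U e (inj₁ a) (inj₁ b) = toℕ-injective (trans (sym a) b)
end-neighbour-unique U e (inj₂ a) _ = case trans a e of λ ()
end-neighbour-unique U e _ (inj₂ b) = case trans b e of λ ()
end-neighbour-unique V e (inj₂ a) (inj₂ b) = toℕ-injective (ℕₚ.suc-injective (trans a (sym b)))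
end-neighbour-unique V {k = k} e (inj₁ a) _ =
  contradiction (trans (sym a) e) (ℕₚ.<⇒≢ (toℕ<n k))
end-neighbour-unique V {l = l} e _ (inj₁ b) =
  contradiction (trans (sym b) e) (ℕₚ.<⇒≢ (toℕ<n l))

centre-nonzero : 5 ≤ n → {c : Fin n} → Centre c → toℕ c ≢ 0
centre-nonzero (s≤s (s≤s _)) {c} ctr c≡0 with subst (λ x → x + suc x ≡ _) c≡0 (centre-toℕ ctr)
... | ()

centre-not-end : 5 ≤ n → ∀ σ {c : Fin n} → Centre c → ¬ IsEnd σ c
centre-not-end 5≤n U ctr = centre-nonzero 5≤n ctr
centre-not-end 5≤n V ctr e = centre-nonzero 5≤n ctr (subst (IsEnd U) ctr (end-opposite V e))

pred-adj : (j : Fin n) → toℕ j ≢ 0 → ∃ λ k → Adj j k × suc (toℕ k) ≡ toℕ j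
pred-adj {n} j j≢0 with toℕ j in eq
... | zero = contradiction refl j≢0
... | suc m = fromℕ< m<n , inj₂ (cong suc (toℕ-fromℕ< m<n)) , cong suc (toℕ-fromℕ< m<n)
  where
  m<n : m < n
  m<n = ℕₚ.<-trans (ℕₚ.n<1+n m) (subst (_< n) eq (toℕ<n j))

neighbour : 2 ≤ n → (j : Fin n) → ∃ λ k → Adj j k
neighbour (s≤s (s≤s _)) zero = suc zero , inj₁ refl
neighbour _ (suc j) with pred-adj (suc j) (λ ())
... | k , adj , _ = k , adj

-- The positions of `j` and `opposite j` add up to `n - 1`, which is twice the position of the
-- centre.
below-centre : {c : Fin n} → Centre c → (j : Fin n) → toℕ c < toℕ j → toℕ (opposite j) < toℕ c
below-centre {c = c} ctr j c<j = ℕₚ.≰⇒> λ c≤opp → ℕₚ.<-irrefl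
  (trans (centre-toℕ ctr) (sym (toℕ-opposite j)))
  (ℕₚ.+-mono-≤-< c≤opp (s≤s c<j))

neighbour-below-centre : 5 ≤ n → {c : Fin n} → Centre c → (j : Fin n) → toℕ j < toℕ c →
                         ∃ λ k → Adj j k × k ≢ c
neighbour-below-centre {n} 5≤n {c} ctr j j<c with toℕ j ℕ.≟ 0
... | no j≢0 with pred-adj j j≢0
...   | k , adj , sk≡j = k , adj , λ { refl → ℕₚ.<-asym j<c (ℕₚ.≤-reflexive sk≡j) }
neighbour-below-centre {n} 5≤n {c} ctr j j<c | yes j≡0 =
  fromℕ< 1<n , inj₁ (trans (cong suc j≡0) (sym toℕ1)) , 1≢c
  where
  1<n : 1 < n
  1<n = ℕₚ.≤-trans (s≤s (s≤s z≤n)) 5≤n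
  toℕ1 : toℕ (fromℕ< 1<n) ≡ 1
  toℕ1 = toℕ-fromℕ< 1<n
  1≢c : fromℕ< 1<n ≢ c
  -- A centre at position 1 would mean `n = 1 + 2`, fewer than five edges.
  1≢c refl = case subst (5 ≤_) (trans (sym (centre-toℕ ctr)) (cong (λ x → x + suc x) toℕ1)) 5≤n
             of λ { (s≤s (s≤s (s≤s ()))) }

-- With this an off-centre edge can be forced although the centre is free. Edges beyond the centre
-- are reflected to the first half.
neighbour-off-centre : 5 ≤ n → {c : Fin n} → Centre c → (j : Fin n) → j ≢ c →
                       ∃ λ k → Adj j k × k ≢ c
neighbour-off-centre 5≤n {c} ctr j j≢c with ℕₚ.<-cmp (toℕ j) (toℕ c)
... | tri< j<c _ _ = neighbour-below-centre 5≤n ctr j j<c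
... | tri≈ _ j≡c _ = contradiction (toℕ-injective j≡c) j≢c
... | tri> _ _ c<j with neighbour-below-centre 5≤n ctr (opposite j) (below-centre ctr j c<j)
...   | k , adj , k≢c =
  opposite k ,
  subst (λ x → Adj x (opposite k)) (opposite-involutive j) (Adj-opposite adj) ,
  λ opp≡c → k≢c (trans (opposite-swap opp≡c) ctr)

-- Reflection fixes the centre and so exchanges its two neighbours.
centre-neighbours : {c j k : Fin n} → Centre c → Adj c j → Adj c k → k ≡ j ⊎ k ≡ opposite j
centre-neighbours ctr (inj₁ a) (inj₁ b) = inj₁ (toℕ-injective (trans (sym b) a))
centre-neighbours ctr (inj₂ a) (inj₂ b) =
  inj₁ (toℕ-injective (ℕₚ.suc-injective (trans b (sym a))))
centre-neighbours {c = c} {j} {k} ctr (inj₁ a) (inj₂ b) = inj₂ (toℕ-injective (ℕₚ.suc-injective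
  (trans b (trans (cong toℕ (sym ctr)) (sym (suc-opposite {j = c} {j} a))))))
centre-neighbours {c = c} {j} {k} ctr (inj₂ a) (inj₁ b) = inj₂ (toℕ-injective
  (trans (sym b) (trans (cong (suc ∘ toℕ) (sym ctr)) (suc-opposite {j = j} {c} a))))

-- Partial orientations of a path

Smooth : (Fin n → Maybe Dir) → Set
Smooth f = ∀ {j k} → suc (toℕ j) ≡ toℕ k → ∀ {d d'} → f j ≡ just d → f k ≡ just d' → d ≡ d'

smooth-adj : {f : Fin n → Maybe Dir} → Smooth f → ∀ {j k} → Adj j k →
             ∀ {d d'} → f j ≡ just d → f k ≡ just d' → d ≡ d'
smooth-adj sm (inj₁ a) fj fk = sm a fj fk
smooth-adj sm (inj₂ a) fj fk = sym (sm a fk fj)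

smooth-suc : {f : Fin (suc n) → Maybe Dir} → Smooth f → Smooth (f ∘ suc)
smooth-suc sm a = sm (cong suc a)

-- Only the inner vertices of the path are considered; sinks and sources at `u` and `v` are treated
-- separately.
Fits : (Fin n → Maybe Dir) → Fin n → Dir → Set
Fits f j d = ∀ {k} → Adj j k → ∀ {d'} → f k ≡ just d' → d' ≡ d

Playable : (Fin n → Maybe Dir) → Set
Playable f = ∃₂ λ j d → f j ≡ nothing × Fits f j d

-- A prepended edge could only spoil a move on the edge next to it, and that edge is already
-- directed.
playable-suc : {f : Fin (suc (suc n)) → Maybe Dir} {a : Dir} → f (suc zero) ≡ just a →
               Playable (f ∘ suc) → Playable f
playable-suc {f = f} {a} f1 (j , d , fj , fits) = suc j , d , fj , fits′
  where
  fits′ : Fits f (suc j) d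
  fits′ {zero} (inj₂ 1≡sj) fk =
    contradiction (subst (λ x → f (suc x) ≡ just a) (toℕ-injective {j = j} (ℕₚ.suc-injective 1≡sj)) f1)
                  (nothing≢just fj)
  fits′ {suc k} (inj₁ a) = fits (inj₁ (ℕₚ.suc-injective a))
  fits′ {suc k} (inj₂ a) = fits (inj₂ (ℕₚ.suc-injective a))

data Balance (a b : Dir) (m : ℕ) : Set where
  agree  : a ≡ b → 2 ∣ m → Balance a b m
  differ : a ≢ b → 2 ∣ suc m → Balance a b m

-- As there are only two directions, `c ≢ a` toggles agreement with `b`, while the extra free edge
-- toggles the parity.
Balance-step : ∀ {a b c m} → c ≢ a → Balance c b m → Balance a b (suc m)
Balance-step c≢a (agree c≡b even) = differ (λ a≡b → c≢a (trans c≡b (sym a≡b))) (even-suc-suc even)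
Balance-step c≢a (differ c≢b even) = agree (trans (≢⇒flip (λ a≡c → c≢a (sym a≡c))) (sym (≢⇒flip (λ b≡c → c≢b (sym b≡c))))) even

-- In a path without a playable edge every free edge is isolated and separates opposite directions.
balance : ∀ n (f : Fin (suc n) → Maybe Dir) {a b} → Smooth f → f zero ≡ just a →
          (∀ j → IsEnd V j → f j ≡ just b) → Playable f ⊎ Balance a b (total (free ∘ f))
balance zero f sm f0 fv =
  inj₂ (agree (just-injective (trans (sym f0) (fv zero refl)))
              (subst (λ x → 2 ∣ free x + 0) (sym f0) (2 ∣0)))
balance (suc n) f sm f0 fv rewrite f0 with f (suc zero) in f1
balance (suc n) f sm f0 fv | just _ with sm {zero} {suc zero} refl f0 f1
... | refl with balance n (f ∘ suc) (smooth-suc {f = f} sm) f1 (λ j e → fv (suc j) (cong suc e))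
...   | inj₁ playable = inj₁ (playable-suc f1 playable)
...   | inj₂ bal rewrite f1 = inj₂ bal
balance (suc zero) f sm f0 fv | nothing = contradiction (fv (suc zero) refl) (nothing≢just f1)
balance (suc (suc n)) f {a} sm f0 fv | nothing with f (suc (suc zero)) in f2
... | nothing = inj₁ (suc zero , a , f1 , λ
  { {zero} _ f0′ → just-injective (trans (sym f0′) f0)
  ; {suc zero} _ fk → contradiction fk (nothing≢just f1)
  ; {suc (suc zero)} _ fk → contradiction fk (nothing≢just f2)
  ; {suc (suc (suc k))} (inj₁ ()) ; {suc (suc (suc k))} (inj₂ ()) })
... | just c with c ≟ᴰ a
...   | yes refl = inj₁ (suc zero , a , f1 , λ
  { {zero} _ f0′ → just-injective (trans (sym f0′) f0)
  ; {suc zero} _ fk → contradiction fk (nothing≢just f1)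
  ; {suc (suc zero)} _ fk → just-injective (trans (sym fk) f2)
  ; {suc (suc (suc k))} (inj₁ ()) ; {suc (suc (suc k))} (inj₂ ()) })
...   | no c≢a with balance n (λ j → f (suc (suc j))) (smooth-suc {f = f ∘ suc} (smooth-suc {f = f} sm)) f2
                       (λ j e → fv (suc (suc j)) (cong (λ x → suc (suc x)) e))
...     | inj₂ bal rewrite f2 = inj₂ (Balance-step c≢a bal)
...     | inj₁ (j , d , fj , fits) = inj₁ (suc (suc j) , d , fj , λ
  { {zero} (inj₁ ()) ; {zero} (inj₂ ())
  ; {suc zero} _ fk → contradiction fk (nothing≢just f1)
  ; {suc (suc k)} (inj₁ e) → fits (inj₁ (ℕₚ.suc-injective (ℕₚ.suc-injective e)))
  ; {suc (suc k)} (inj₂ e) → fits (inj₂ (ℕₚ.suc-injective (ℕₚ.suc-injective e))) })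

balance-path : 1 ≤ n → (f : Fin n → Maybe Dir) → ∀ {a b} → Smooth f →
               (∀ j → IsEnd U j → f j ≡ just a) → (∀ j → IsEnd V j → f j ≡ just b) →
               Playable f ⊎ Balance a b (total (free ∘ f))
balance-path {suc n} _ f sm fu fv = balance n f sm (fu zero refl) fv

-- Smoothness carries the direction through the half before the centre, and symmetry copies it to
-- the other half. The centre may be free, so the chain cannot cross it.
constant-off-centre : {f : Fin n → Maybe Dir} {c : Fin n} → Smooth f → Centre c →
  (∀ j → f (opposite j) ≡ f j) → (∀ j → j ≢ c → ∃ λ d → f j ≡ just d) →
  ∀ {e d} → e ≢ c → f e ≡ just d → ∀ j → j ≢ c → f j ≡ just d
constant-off-centre {n} {f} {c} sm ctr symm marked {e} {d} e≢c fe j j≢c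
  with below j j≢c | below e e≢c
  where
  below : ∀ j → j ≢ c → ∃ λ k → toℕ k < toℕ c × f k ≡ f j
  below j j≢c with ℕₚ.<-cmp (toℕ j) (toℕ c)
  ... | tri< j<c _ _ = j , j<c , refl
  ... | tri≈ _ j≡c _ = contradiction (toℕ-injective j≡c) j≢c
  ... | tri> _ _ c<j = opposite j , below-centre ctr j c<j , symm j
... | k₀ , k₀<c , eqⱼ | l₀ , l₀<c , eqₑ =
  trans (sym eqⱼ) (trans (chain k₀ l₀ k₀<c l₀<c) (trans eqₑ fe))
  where
  -- Descent to the edge at `u`, by recursion on the position `m` of `k`.
  first : ∀ m (k : Fin n) → toℕ k ≡ m → toℕ k < toℕ c → ∀ {o : Fin n} → toℕ o ≡ 0 → f k ≡ f o
  first zero k k≡0 _ o≡0 = cong f (toℕ-injective (trans k≡0 (sym o≡0)))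
  first (suc m) k k≡sm k<c o≡0 with pred-adj k (λ k≡0 → case trans (sym k≡0) k≡sm of λ ())
  ... | l , _ , sl≡k = trans step (first m l (ℕₚ.suc-injective (trans sl≡k k≡sm)) l<c o≡0)
    where
    l<c : toℕ l < toℕ c
    l<c = ℕₚ.<-trans (ℕₚ.≤-reflexive sl≡k) k<c
    step : f k ≡ f l
    step with marked k (λ { refl → ℕₚ.<-irrefl refl k<c }) | marked l (λ { refl → ℕₚ.<-irrefl refl l<c })
    ... | _ , fk | _ , fl = trans fk (trans (cong just (sym (sm sl≡k fl fk))) (sym fl))
  chain : ∀ (k l : Fin n) → toℕ k < toℕ c → toℕ l < toℕ c → f k ≡ f l
  chain k l k<c l<c with end-exists (ℕₚ.≤-trans (s≤s z≤n) (toℕ<n c)) U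
  ... | o , o≡0 = trans (first _ k refl k<c o≡0) (sym (first _ l refl l<c o≡0))

balance-from : ∀ τ → 1 ≤ n → (f : Fin n → Maybe Dir) → ∀ {a b} → Smooth f →
               (∀ j → IsEnd τ j → f j ≡ just a) → (∀ j → IsEnd (other τ) j → f j ≡ just b) →
               Playable f ⊎ Balance a b (total (free ∘ f))
balance-from U 1≤n f sm fa fb = balance-path 1≤n f sm fa fb
balance-from V 1≤n f sm fa fb = map₂ Balance-sym (balance-path 1≤n f sm fb fa)
  where
  Balance-sym : ∀ {a b m} → Balance a b m → Balance b a m
  Balance-sym (agree a≡b even) = agree (sym a≡b) even
  Balance-sym (differ a≢b even) = differ (λ b≡a → a≢b (sym b≡a)) even

-- In a smooth orientation extending `f`, the edge `j` can have no direction but `d`.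
Forced : (Fin n → Maybe Dir) → Fin n → Dir → Set
Forced f j d = ∃ λ k → Adj j k × f k ≡ just d

-- Lawful positions and the effect of one move

module Strategy (p : ℕ) (len : Fin p → ℕ)
                (2≤len : ∀ i → 2 ≤ len i) (5≤odd : ∀ i → 2 ∣ suc (len i) → 5 ≤ len i) where

  open ThetaGame p len

  endOf : ∀ σ i → Fin (len i)
  endOf σ i = proj₁ (end-exists (ℕₚ.≤-trans (s≤s z≤n) (2≤len i)) σ)

  endOf-isEnd : ∀ σ i → IsEnd σ (endOf σ i)
  endOf-isEnd σ i = proj₂ (end-exists (ℕₚ.≤-trans (s≤s z≤n) (2≤len i)) σ)

  Constant : Side → Dir → State → Set
  Constant σ d s = ∀ i (j : Fin (len i)) → IsEnd σ j → s i j ≡ just d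

  -- A form of `Legal` suited to reflection: all ends `fwd` is a source at `u` but a sink at `v`, so
  -- forbidding a constant side covers all four conditions at `u` and `v`.
  record Lawful (s : State) : Set where
    field
      smooth : ∀ i → Smooth (s i)
      mixed  : ∀ σ d → ¬ Constant σ d s

  open Lawful

  legal⇒lawful : ∀ {s} → Legal s → Lawful s
  legal⇒lawful (¬usink , ¬usource , ¬vsink , ¬vsource , ¬internal) = record
    { smooth = λ i → λ
      { a {fwd} {fwd} _ _ → refl
      ; a {fwd} {bwd} sj sk → contradiction (i , _ , _ , a , inj₁ (sj , sk)) ¬internal
      ; a {bwd} {fwd} sj sk → contradiction (i , _ , _ , a , inj₂ (sj , sk)) ¬internal
      ; a {bwd} {bwd} _ _ → refl }
    ; mixed = λ { U fwd → ¬usource ; U bwd → ¬usink ; V fwd → ¬vsink ; V bwd → ¬vsource } }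

  lawful⇒legal : ∀ {s} → Lawful s → Legal s
  lawful⇒legal law =
    mixed law U bwd , mixed law U fwd , mixed law V fwd , mixed law V bwd , λ
    { (i , j , k , a , inj₁ (sj , sk)) → case smooth law i a sj sk of λ ()
    ; (i , j , k , a , inj₂ (sj , sk)) → case smooth law i a sj sk of λ () }

  infix 4 _⊑_
  _⊑_ : State → State → Set
  s ⊑ t = ∀ i j {d} → s i j ≡ just d → t i j ≡ just d

  smooth-⊑ : ∀ {s t} → s ⊑ t → (∀ i → Smooth (t i)) → ∀ i → Smooth (s i)
  smooth-⊑ s⊑t sm i a sj sk = sm i a (s⊑t i _ sj) (s⊑t i _ sk)

  -- A sink or source has all its edges directed and so persists in every extension. Hence legality
  -- of the committed orientation suffices for the actual position.
  lawful-⊑ : ∀ {s t} → s ⊑ t → Lawful t → Lawful s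
  lawful-⊑ s⊑t law = record
    { smooth = smooth-⊑ s⊑t (smooth law)
    ; mixed = λ σ d const → mixed law σ d (λ i j e → s⊑t i j (const i j e)) }

  fits-⊑ : ∀ {s t} → s ⊑ t → ∀ {i j d} → Fits (t i) j d → Fits (s i) j d
  fits-⊑ s⊑t fits a sk = fits a (s⊑t _ _ sk)

  Edge : Set
  Edge = Σ (Fin p) (Fin ∘ len)

  -- The two nested comparisons in `update` become one case split, on equality of edges as dependent
  -- pairs.
  data UpdateView (s : State) (i : Fin p) (j : Fin (len i)) (d : Dir) :
                  (i' : Fin p) (j' : Fin (len i')) → Maybe Dir → Set where
    hit  : UpdateView s i j d i j (just d)
    miss : ∀ {i' j'} → _≢_ {A = Edge} (i' , j') (i , j) → UpdateView s i j d i' j' (s i' j')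

  updateView : ∀ s i j d i' j' → UpdateView s i j d i' j' (update s i j d i' j')
  updateView s i j d i' j' with i' ≟ i
  ... | no i'≢i = miss λ eq → i'≢i (cong proj₁ eq)
  ... | yes refl with j' ≟ j
  ...   | yes refl = hit
  ...   | no j'≢j = miss λ { refl → j'≢j refl }

  update-hit : ∀ s i j d → update s i j d i j ≡ just d
  update-hit s i j d with update s i j d i j | updateView s i j d i j
  ... | _ | hit = refl
  ... | _ | miss ≢ = contradiction refl ≢

  update-miss : ∀ s {i j d i' j'} → _≢_ {A = Edge} (i' , j') (i , j) → update s i j d i' j' ≡ s i' j'
  update-miss s {i} {j} {d} {i'} {j'} ≢ with update s i j d i' j' | updateView s i j d i' j'
  ... | _ | hit = contradiction refl ≢
  ... | _ | miss _ = refl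

  update-edge : ∀ s {i j d j'} → j' ≢ j → update s i j d i j' ≡ s i j'
  update-edge s j'≢j = update-miss s λ { refl → j'≢j refl }

  update-path : ∀ s {i j d i'} → i' ≢ i → ∀ j' → update s i j d i' j' ≡ s i' j'
  update-path s i'≢i j' = update-miss s λ eq → i'≢i (cong proj₁ eq)

  update-grows : ∀ {s i j d} → s i j ≡ nothing → s ⊑ update s i j d
  update-grows {s} {i} {j} {d} sij i' j' eq with update s i j d i' j' | updateView s i j d i' j'
  ... | _ | hit = contradiction eq (nothing≢just sij)
  ... | _ | miss _ = eq

  update-⊑ : ∀ {s t i j d} → s ⊑ t → update s i j d ⊑ update t i j d
  update-⊑ {s} {t} {i} {j} {d} s⊑t i' j' eq
    with update s i j d i' j' | updateView s i j d i' j'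
  ... | _ | hit = trans (update-hit t i j d) eq
  ... | _ | miss ≢ = trans (update-miss t ≢) (s⊑t i' j' eq)

  update-below : ∀ {s t i j d} → s ⊑ t → t i j ≡ just d → update s i j d ⊑ t
  update-below {s} {t} {i} {j} {d} s⊑t tij i' j' eq
    with update s i j d i' j' | updateView s i j d i' j'
  ... | _ | hit = trans tij eq
  ... | _ | miss _ = s⊑t i' j' eq

  update-fits : ∀ {s i j d} → s i j ≡ nothing → Smooth (update s i j d i) → Fits (s i) j d
  update-fits {s} {i} {j} {d} sij sm a sk =
    sym (smooth-adj sm a (update-hit s i j d) (update-grows {s} sij _ _ sk))

  update-smooth : ∀ {s i j d} → (∀ i' → Smooth (s i')) → Fits (s i) j d →
                  ∀ i' → Smooth (update s i j d i')
  update-smooth {s} {i} {j} {d} sm fits i' {k} {l} a uk ul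
    with update s i j d i' k | updateView s i j d i' k
       | update s i j d i' l | updateView s i j d i' l
  ... | _ | hit | _ | hit = trans (sym (just-injective uk)) (just-injective ul)
  ... | _ | hit | _ | miss _ = trans (sym (just-injective uk)) (sym (fits (inj₁ a) ul))
  ... | _ | miss _ | _ | hit = trans (fits (inj₂ a) uk) (just-injective ul)
  ... | _ | miss _ | _ | miss _ = sm i' a uk ul

  update-mixed : ∀ {s i j d σ} → ¬ IsEnd σ j → ∀ {d'} → ¬ Constant σ d' s →
                 ¬ Constant σ d' (update s i j d)
  update-mixed {s} {i} {j} {d} ¬end ¬const const = ¬const λ i' j' e →
    trans (sym (update-miss s λ { refl → ¬end e })) (const i' j' e)

  update-lawful : ∀ {s i j d} → Lawful s → Fits (s i) j d → (∀ σ → ¬ IsEnd σ j) →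
                  Lawful (update s i j d)
  update-lawful {s} law fits ¬end = record
    { smooth = update-smooth {s} (smooth law) fits
    ; mixed = λ σ d → update-mixed {s} (¬end σ) (mixed law σ d) }

  -- Weighted counts of edges

  Weight : Set
  Weight = ∀ {n} → Fin n → Maybe Dir → ℕ

  -- The weight sees the place of an edge, so the same step lemmas serve for counting free edges and
  -- free centres.
  measure : Weight → State → ℕ
  measure φ s = total λ i → total λ j → φ j (s i j)

  measure-step : (φ : Weight) → ∀ {s i j d} → φ j (s i j) ≡ suc (φ j (just d)) →
                 measure φ s ≡ suc (measure φ (update s i j d))
  measure-step φ {s} {i} {j} {d} eq = total-step i
    (total-step j (trans eq (cong (suc ∘ φ j) (sym (update-hit s i j d))))
                  (λ k k≢j → cong (φ k) (sym (update-edge s k≢j))))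
    (λ k k≢i → total-cong λ l → cong (φ l) (sym (update-path s k≢i l)))

  measure-same : (φ : Weight) → ∀ {s i j d} → φ j (s i j) ≡ φ j (just d) →
                 measure φ s ≡ measure φ (update s i j d)
  measure-same φ {s} {i} {j} {d} eq = total-cong λ k → total-cong λ l → pointwise k l
    where
    pointwise : ∀ k l → φ l (s k l) ≡ φ l (update s i j d k l)
    pointwise k l with update s i j d k l | updateView s i j d k l
    ... | _ | hit = eq
    ... | _ | miss _ = refl

  freeEdges : State → ℕ
  freeEdges = measure λ _ → free

  freeEdges-step : ∀ {s i j d} → s i j ≡ nothing → freeEdges s ≡ suc (freeEdges (update s i j d))
  freeEdges-step sij = measure-step (λ _ → free) (cong free sij)

  Move : State → Set
  Move s = Σ (Fin p) λ i → ∃₂ λ j d → s i j ≡ nothing × Lawful (update s i j d)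

  -- The endgame

  Tight : Side → Dir → State → Set
  Tight σ d s = ∀ i (j : Fin (len i)) → IsEnd σ j → ∀ {d'} → s i j ≡ just d' → d' ≡ d

  OneAgainst : Side → Dir → Fin p → State → Set
  OneAgainst σ d r s =
    (∀ j → IsEnd σ j → s r j ≡ just (flip d)) ×
    (∀ i → i ≢ r → ∀ (j : Fin (len i)) → IsEnd σ j → ∀ {d'} → s i j ≡ just d' → d' ≡ d)

  -- Every free end edge is bound to `d`. The directed ends at `τ` all point as `d`; the other side
  -- may have one exception, on path `r`.
  record Endgame (d : Dir) (τ : Side) (s : State) : Set where
    field
      forced : ∀ σ i j → IsEnd σ j → s i j ≡ nothing → Forced (s i) j d
      tight  : Tight τ d s
      rest   : Tight (other τ) d s ⊎ ∃ λ r → OneAgainst (other τ) d r s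

  open Endgame

  endgame-fits : ∀ {d τ s} → Endgame d τ s → ∀ {σ i j} → IsEnd σ j → s i j ≡ nothing →
                 Fits (s i) j d
  endgame-fits eg {σ} e sij a sk with forced eg _ _ _ e sij
  ... | l , b , sl with end-neighbour-unique σ e a b
  ...   | refl = just-injective (trans (sym sk) sl)

  -- A newly directed end has to copy its forced neighbour and so gets `d`. Hence no choice of
  -- either player leads out of the endgame.
  endgame-step : ∀ {d τ s} → Endgame d τ s → ∀ {i j c} → s i j ≡ nothing → Fits (s i) j c →
                 Endgame d τ (update s i j c)
  endgame-step {d} {τ} {s} eg {i} {j} {c} sij fits = record
    { forced = forced′
    ; tight = tight′ (tight eg)
    ; rest = case rest eg of λ
      { (inj₁ ti) → inj₁ (tight′ ti)
      ; (inj₂ (r , against , others)) → inj₂ (r ,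
          (λ k e → update-grows {s} sij r k (against k e)) ,
          λ i' i'≢r k e {_} → newEnd i' k e (others i' i'≢r k e)) } }
    where
    newEnd : ∀ {σ} i' (k : Fin (len i')) → IsEnd σ k → (∀ {d'} → s i' k ≡ just d' → d' ≡ d) →
             ∀ {d'} → update s i j c i' k ≡ just d' → d' ≡ d
    newEnd i' k e old eq with update s i j c i' k | updateView s i j c i' k
    ... | _ | miss _ = old eq
    ... | _ | hit with forced eg _ i j e sij
    ...   | l , a , sl = trans (sym (just-injective eq)) (sym (fits a sl))
    tight′ : ∀ {σ} → Tight σ d s → Tight σ d (update s i j c)
    tight′ ti i' k e = newEnd i' k e (ti i' k e)
    forced′ : ∀ σ i' k → IsEnd σ k → update s i j c i' k ≡ nothing → Forced (update s i j c i') k d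
    forced′ σ i' k e eq with update s i j c i' k | updateView s i j c i' k
    ... | _ | miss _ with forced eg σ i' k e eq
    ...   | l , a , sl = l , a , update-grows {s} sij i' l sl

  -- A complete cell has two opposite end edges at `τ`, where all directed ends point as `d`.
  endgame-no-cell : ∀ {d τ s} → Endgame d τ s → ¬ CellComplete s
  endgame-no-cell {d} {τ} eg (i , i' , _ , inj₁ (allFwd , allBwd)) with d
  ... | fwd = case tight eg i' _ (endOf-isEnd τ i') (allBwd _) of λ ()
  ... | bwd = case tight eg i _ (endOf-isEnd τ i) (allFwd _) of λ ()
  endgame-no-cell {d} {τ} eg (i , i' , _ , inj₂ (allBwd , allFwd)) with d
  ... | fwd = case tight eg i _ (endOf-isEnd τ i) (allBwd _) of λ ()
  ... | bwd = case tight eg i' _ (endOf-isEnd τ i') (allFwd _) of λ ()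

  same-or-other : ∀ σ σ' → σ' ≡ σ ⊎ σ' ≡ other σ
  same-or-other U U = inj₁ refl
  same-or-other U V = inj₂ refl
  same-or-other V U = inj₂ refl
  same-or-other V V = inj₁ refl

  at-end : ∀ {σ i x} {s : State} → s i (endOf σ i) ≡ x → ∀ j → IsEnd σ j → s i j ≡ x
  at-end {σ} {i} {s = s} eq j e = trans (cong (s i) (end-unique σ e (endOf-isEnd σ i))) eq

  opposite-ends : ∀ σ {i i'} {j : Fin (len i)} {j' : Fin (len i')} → IsEnd σ j → IsEnd (other σ) j' →
                  _≢_ {A = Edge} (i' , j') (i , j)
  opposite-ends σ {i} e e' refl = ends-distinct (2≤len i) σ e e'

  -- The forced neighbour makes `d` fit, and the edge is not also an end on the other side, so only
  -- a constant side `σ` could make the move illegal.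
  fill-end : ∀ {d τ s σ i j} → Endgame d τ s → Lawful s → IsEnd σ j → s i j ≡ nothing →
             (∀ d' → ¬ Constant σ d' (update s i j d)) → Move s
  fill-end {d} {τ} {s} {σ} {i} {j} eg law e sij ¬const = i , j , d , sij , record
    { smooth = update-smooth {s} (smooth law) (endgame-fits eg e sij)
    ; mixed = mixed′ }
    where
    mixed′ : ∀ σ' d' → ¬ Constant σ' d' (update s i j d)
    mixed′ σ' d' with same-or-other σ σ'
    ... | inj₁ refl = ¬const d'
    ... | inj₂ refl = update-mixed {s} (ends-distinct (2≤len i) σ e) (mixed law σ' d')

  -- As the position is lawful, some end is not `d`, and by tightness it is free. It keeps the side
  -- from being constant, so any second free end can be filled.
  tight-side : ∀ {d τ s} → Endgame d τ s → Lawful s → ∀ {σ} → Tight σ d s →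
               Move s ⊎ ∃ λ q → s q (endOf σ q) ≡ nothing ×
                                (∀ i → i ≢ q → s i (endOf σ i) ≡ just d)
  tight-side {d} {τ} {s} eg law {σ} ti
    with all? (λ i → s i (endOf σ i) ≟ᴹ just d)
  ... | yes all = contradiction (λ i → at-end {s = s} (all i)) (mixed law σ d)
  ... | no ¬all with ¬∀⟶∃¬ _ _ (λ i → s i (endOf σ i) ≟ᴹ just d) ¬all
  ...   | q , ≢d with marked-or-free (s q (endOf σ q))
  ...     | inj₁ (d' , eq) =
    contradiction (trans eq (cong just (ti q _ (endOf-isEnd σ q) eq))) ≢d
  ...     | inj₂ sq = map₂ (λ marked → q , sq , marked) (all-unless fillOther)
    where
    fillOther : ∀ i → Move s ⊎ (i ≢ q → s i (endOf σ i) ≡ just d)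
    fillOther i with i ≟ q | marked-or-free (s i (endOf σ i))
    ... | yes i≡q | _ = inj₂ λ i≢q → contradiction i≡q i≢q
    ... | no _ | inj₁ (d' , eq) =
      inj₂ λ _ → trans eq (cong just (ti i _ (endOf-isEnd σ i) eq))
    ... | no i≢q | inj₂ si = inj₁ (fill-end eg law (endOf-isEnd σ i) si λ d' const →
      nothing≢just sq (trans (sym (update-path s (λ q≡i → i≢q (sym q≡i)) (endOf σ q)))
                             (const q (endOf σ q) (endOf-isEnd σ q))))

  -- The end on path `r` points against `d` and keeps the side mixed, so any free end can be filled.
  mixed-side : ∀ {d τ s} → Endgame d τ s → Lawful s → ∀ {σ r} → OneAgainst σ d r s →
               Move s ⊎ (∀ i → i ≢ r → s i (endOf σ i) ≡ just d)
  mixed-side {d} {τ} {s} eg law {σ} {r} (against , others) = all-unless fillOther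
    where
    fillOther : ∀ i → Move s ⊎ (i ≢ r → s i (endOf σ i) ≡ just d)
    fillOther i with i ≟ r | marked-or-free (s i (endOf σ i))
    ... | yes i≡r | _ = inj₂ λ i≢r → contradiction i≡r i≢r
    ... | no i≢r | inj₁ (d' , eq) =
      inj₂ λ _ → trans eq (cong just (others i i≢r _ (endOf-isEnd σ i) eq))
    ... | no i≢r | inj₂ si = inj₁ (fill-end eg law (endOf-isEnd σ i) si λ d' const →
      flip-≢ d (just-injective (trans
        (sym (trans (update-path s (λ r≡i → i≢r (sym r≡i)) _) (against _ (endOf-isEnd σ r))))
        (trans (const r _ (endOf-isEnd σ r))
               (trans (sym (const i _ (endOf-isEnd σ i))) (update-hit s i _ d))))))

  update-all-ends : ∀ {σ d q s} → s q (endOf σ q) ≡ nothing →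
                    (∀ i → i ≢ q → s i (endOf σ i) ≡ just d) →
                    ∀ i → update s q (endOf σ q) d i (endOf σ i) ≡ just d
  update-all-ends {σ} {d} {q} {s} sq marked i = case i ≟ q of λ
    { (yes refl) → update-hit s i (endOf σ i) d
    ; (no i≢q) → update-grows {s} sq i _ (marked i i≢q) }

  -- `t` may have a sink or source at `u` or `v`, so only its smoothness is asked. It directs all
  -- ends; a playable edge of `t` is therefore no end, and directing it is lawful in `s`.
  settle : ∀ τ {s t} → Lawful s → s ⊑ t → (∀ i → Smooth (t i)) → (a b : Fin p → Dir) →
           (∀ i → t i (endOf τ i) ≡ just (a i)) → (∀ i → t i (endOf (other τ) i) ≡ just (b i)) →
           Move s ⊎ (∀ i → Balance (a i) (b i) (total (free ∘ t i)))
  settle τ {s} {t} law s⊑t sm a b ta tb = all-unless λ i → map₁ (toMove i)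
    (balance-from τ (ℕₚ.≤-trans (s≤s z≤n) (2≤len i)) (t i) (sm i)
                  (at-end {s = t} (ta i)) (at-end {s = t} (tb i)))
    where
    toMove : ∀ i → Playable (t i) → Move s
    toMove i (j , d , tij , fits) = i , j , d , sij ,
      update-lawful law (fits-⊑ {s} {t} s⊑t fits) ¬end
      where
      sij : s i j ≡ nothing
      sij with marked-or-free (s i j)
      ... | inj₁ (_ , eq) = contradiction (s⊑t i j eq) (nothing≢just tij)
      ... | inj₂ eq = eq
      ¬end : ∀ σ → ¬ IsEnd σ j
      ¬end σ e with same-or-other τ σ
      ... | inj₁ refl = nothing≢just tij (at-end {τ} {s = t} (ta i) j e)
      ... | inj₂ refl = nothing≢just tij (at-end {other τ} {s = t} (tb i) j e)

  balanced-even : ∀ {a m} → Balance a a m → 2 ∣ m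
  balanced-even (agree _ even) = even
  balanced-even (differ a≢a _) = contradiction refl a≢a

  flip-balanced-odd : ∀ {a m} → Balance a (flip a) m → 2 ∣ suc m
  flip-balanced-odd (agree a≡fa _) = contradiction (sym a≡fa) (flip-≢ _)
  flip-balanced-odd (differ _ odd) = odd

  -- Fill the one end edge that must stay free on each tight side; without a move, every path then
  -- has an even number of free edges, except the one whose ends disagree.
  endgame-move : ∀ {d τ s} → Endgame d τ s → Lawful s → 2 ∣ suc (freeEdges s) → Move s
  endgame-move {d} {τ} {s} eg law odd with tight-side eg law (tight eg)
  ... | inj₁ move = move
  ... | inj₂ (q , sq , marked) = go (rest eg)
    where
    s₁ : State
    s₁ = update s q (endOf τ q) d
    fits₁ : Fits (s q) (endOf τ q) d
    fits₁ = endgame-fits eg (endOf-isEnd τ q) sq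
    eg₁ : Endgame d τ s₁
    eg₁ = endgame-step eg sq fits₁
    sm₁ : ∀ i → Smooth (s₁ i)
    sm₁ = update-smooth {s} (smooth law) fits₁
    s⊑s₁ : s ⊑ s₁
    s⊑s₁ = update-grows {s} sq
    count₁ : freeEdges s ≡ suc (freeEdges s₁)
    count₁ = freeEdges-step {s} sq
    ends₁ : ∀ i → s₁ i (endOf τ i) ≡ just d
    ends₁ = update-all-ends {s = s} sq marked
    go : Tight (other τ) d s ⊎ (∃ λ r → OneAgainst (other τ) d r s) → Move s
    go (inj₁ ti) with tight-side eg law ti
    ... | inj₁ move = move
    ... | inj₂ (q' , sq' , marked') =
      [ (λ move → move)
      , (λ bal → contradiction odd (not-both-even (subst (2 ∣_) (sym (trans count₁ (cong suc count₂)))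
          (even-suc-suc (total-even (λ i → balanced-even (bal i)))))))
      ]′ (settle τ law (λ i j eq → s₁⊑s₂ i j (s⊑s₁ i j eq)) sm₂ (λ _ → d) (λ _ → d)
                 (λ i → s₁⊑s₂ i _ (ends₁ i)) ends₂)
      where
      s₁q' : s₁ q' (endOf (other τ) q') ≡ nothing
      s₁q' = trans (update-miss s (opposite-ends τ (endOf-isEnd τ q) (endOf-isEnd (other τ) q'))) sq'
      s₂ : State
      s₂ = update s₁ q' (endOf (other τ) q') d
      s₁⊑s₂ : s₁ ⊑ s₂
      s₁⊑s₂ = update-grows {s₁} s₁q'
      count₂ : freeEdges s₁ ≡ suc (freeEdges s₂)
      count₂ = freeEdges-step {s₁} s₁q'
      sm₂ : ∀ i → Smooth (s₂ i)
      sm₂ = update-smooth {s₁} sm₁ (endgame-fits eg₁ (endOf-isEnd (other τ) q') s₁q')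
      ends₂ : ∀ i → s₂ i (endOf (other τ) i) ≡ just d
      ends₂ = update-all-ends {s = s₁} s₁q' (λ i i≢q' → s⊑s₁ i (endOf (other τ) i) (marked' i i≢q'))
    go (inj₂ (r , against , others)) with mixed-side eg law (against , others)
    ... | inj₁ move = move
    ... | inj₂ marked' =
      [ (λ move → move)
      , (λ bal → contradiction odd (not-both-even (subst (2 ∣_) (sym count₁)
          (total-odd r (flip-balanced-odd (subst (λ b → Balance d b _) b-r (bal r)))
                       (λ i i≢r → balanced-even (subst (λ b → Balance d b _) (b-other i≢r) (bal i)))))))
      ]′ (settle τ law s⊑s₁ sm₁ (λ _ → d) b ends₁ ends₂)
      where
      b : Fin p → Dir
      b i with i ≟ r
      ... | yes _ = flip d
      ... | no _ = d
      b-r : b r ≡ flip d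
      b-r with r ≟ r
      ... | yes _ = refl
      ... | no r≢r = contradiction refl r≢r
      b-other : ∀ {i} → i ≢ r → b i ≡ d
      b-other {i} i≢r with i ≟ r
      ... | yes i≡r = contradiction i≡r i≢r
      ... | no _ = refl
      ends₂ : ∀ i → s₁ i (endOf (other τ) i) ≡ just (b i)
      ends₂ i = case i ≟ r of λ
        { (yes refl) → trans (s⊑s₁ i _ (against _ (endOf-isEnd (other τ) i))) (cong just (sym b-r))
        ; (no i≢r) → trans (s⊑s₁ i _ (marked' i i≢r)) (cong just (sym (b-other i≢r))) }

  -- An odd number of free edges always admits a move, so the player who faces an even number is the
  -- one who runs out of moves.
  lose-endgame : ∀ k {d τ s} → Endgame d τ s → freeEdges s ≡ k * 2 → Lose s
  win-endgame : ∀ k {d τ s} → Endgame d τ s → Lawful s → freeEdges s ≡ suc (k * 2) → Win s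

  lose-endgame zero {s = s} eg count = lose λ i j e sij _ →
    case trans (sym count) (freeEdges-step {s} {d = e} sij) of λ ()
  lose-endgame (suc k) {s = s} eg count = lose λ i j e sij legal →
    let law = legal⇒lawful legal
        eg′ = endgame-step eg sij (update-fits {s} sij (smooth law i))
    in endgame-no-cell eg′ ,
       win-endgame k eg′ law (ℕₚ.suc-injective (trans (sym (freeEdges-step sij)) count))

  win-endgame k {s = s} eg law count with endgame-move eg law
    (subst (2 ∣_) (cong suc (sym count)) (even-suc-suc (divides k refl)))
  ... | i , j , e , sij , law′ = win i j e sij (lawful⇒legal law′)
    (inj₂ (lose-endgame k (endgame-step eg sij (update-fits {s} sij (smooth law′ i)))
                          (ℕₚ.suc-injective (trans (sym (freeEdges-step sij)) count))))

  -- The mirroring strategy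

  Symmetric : State → Set
  Symmetric s = ∀ i (j : Fin (len i)) → s i (opposite j) ≡ s i j

  centreWeight : Weight
  centreWeight j x with Centre? j
  ... | yes _ = free x
  ... | no _ = 0

  centreWeight-centre : ∀ {j : Fin n} → Centre j → ∀ x → centreWeight j x ≡ free x
  centreWeight-centre {j = j} ctr x with Centre? j
  ... | yes _ = refl
  ... | no ¬ctr = contradiction ctr ¬ctr

  centreWeight-other : ∀ {j : Fin n} → ¬ Centre j → ∀ x → centreWeight j x ≡ 0
  centreWeight-other {j = j} ¬ctr x with Centre? j
  ... | yes ctr = contradiction ctr ¬ctr
  ... | no _ = refl

  centreWeight-nonzero : ∀ {j : Fin n} {x} → centreWeight j x ≢ 0 → Centre j × x ≡ nothing
  centreWeight-nonzero {j = j} {x} ≢0 with Centre? j | x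
  ... | yes ctr | nothing = ctr , refl
  ... | yes ctr | just _ = contradiction refl ≢0
  ... | no _ | _ = contradiction refl ≢0

  freeCentres : State → ℕ
  freeCentres = measure centreWeight

  freeCentres-step : ∀ {s i c d} → Centre c → s i c ≡ nothing →
                     freeCentres s ≡ suc (freeCentres (update s i c d))
  freeCentres-step {s} {i} {c} {d} ctr sic = measure-step centreWeight {s} (trans
    (trans (centreWeight-centre ctr (s i c)) (cong free sic))
    (cong suc (sym (centreWeight-centre ctr (just d)))))

  freeCentres-same : ∀ {s i j d} → ¬ Centre j → freeCentres s ≡ freeCentres (update s i j d)
  freeCentres-same {s} {i} {j} {d} ¬ctr = measure-same centreWeight {s}
    (trans (centreWeight-other ¬ctr (s i j)) (sym (centreWeight-other ¬ctr (just d))))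

  -- g is the orientation of the path to which play on it is already committed.
  data PathInv {n} (f g : Fin n → Maybe Dir) : Set where
    exact : (∀ j → f j ≡ g j) →
            (∀ c → Centre c → f c ≡ nothing → ∃ λ j → j ≢ c × f j ≡ nothing) →
            PathInv f g
    pair  : ∀ d x y → x ≢ y → f x ≡ nothing → f y ≡ nothing → (∀ j → g j ≡ just d) →
            (∀ j → j ≢ x → j ≢ y → f j ≡ just d) → Forced f x d → Forced f y d →
            PathInv f g

  PathInv-cong : ∀ {f f' g g' : Fin n → Maybe Dir} → (∀ j → f' j ≡ f j) → (∀ j → g' j ≡ g j) →
                 PathInv f g → PathInv f' g'
  PathInv-cong f'≗f g'≗g (exact f≗g spare) = exact
    (λ j → trans (f'≗f j) (trans (f≗g j) (sym (g'≗g j))))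
    (λ c ctr f'c → case spare c ctr (trans (sym (f'≗f c)) f'c) of λ
      { (j , j≢c , fj) → j , j≢c , trans (f'≗f j) fj })
  PathInv-cong f'≗f g'≗g (pair d x y x≢y fx fy g≗d f≗d (k , xk , fk) (l , yl , fl)) =
    pair d x y x≢y (trans (f'≗f x) fx) (trans (f'≗f y) fy) (λ j → trans (g'≗g j) (g≗d j))
      (λ j j≢x j≢y → trans (f'≗f j) (f≗d j j≢x j≢y))
      (k , xk , trans (f'≗f k) fk) (l , yl , trans (f'≗f l) fl)

  -- The fact behind `no-completion`. In `exact`, a free edge off the centre has a free mirror image
  -- and a free centre has its spare edge; in `pair`, the two edges serve each other.
  second-free : ∀ {f g : Fin n → Maybe Dir} → PathInv f g → (∀ j → g (opposite j) ≡ g j) →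
                ∀ {e} → f e ≡ nothing → ∃ λ j → j ≢ e × f j ≡ nothing
  second-free (exact f≗g spare) symm {e} fe with Centre? e
  ... | yes ctr = spare e ctr fe
  ... | no ¬ctr = opposite e , ¬ctr , trans (f≗g _) (trans (symm e) (trans (sym (f≗g e)) fe))
  second-free (pair d x y x≢y fx fy _ _ _ _) symm {e} fe with x ≟ e
  ... | yes refl = y , (λ y≡x → x≢y (sym y≡x)) , fy
  ... | no x≢e = x , x≢e , fx

  -- `s` is the actual position; `t` adds the edges still free on `pair` paths. Symmetry is asked of
  -- `t` only.
  record Position (s t : State) : Set where
    field
      below     : s ⊑ t
      lawful    : Lawful t
      symmetric : Symmetric t
      paths     : ∀ i → PathInv (s i) (t i)

  open Position

  Inv : State → Set
  Inv s = ∃ λ t → Position s t × 2 ∣ freeCentres t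

  free-below : ∀ {s t} → s ⊑ t → ∀ {i j} → t i j ≡ nothing → s i j ≡ nothing
  free-below {s} s⊑t {i} {j} tij with marked-or-free (s i j)
  ... | inj₁ (_ , sij) = contradiction (s⊑t i j sij) (nothing≢just tij)
  ... | inj₂ sij = sij

  -- By `second-free` the path played on still has a free edge, so a complete cell would avoid it
  -- and would have been complete before the move.
  no-completion : ∀ {s t} → Position s t → ¬ CellComplete s → ∀ {i e d} → s i e ≡ nothing →
                  ¬ CellComplete (update s i e d)
  no-completion {s} {t} pos ¬cell {i} {e} {d} sie (a , a' , adj , full) =
    ¬cell (a , a' , adj , [ (λ (x , y) → inj₁ (before x , before y))
                          , (λ (x , y) → inj₂ (before x , before y)) ]′ full)
    where
    before : ∀ {k c} → (∀ j → update s i e d k j ≡ just c) → ∀ j → s k j ≡ just c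
    before {k} full j = case k ≟ i of λ
      { (yes refl) → case second-free (paths pos k) (symmetric pos k) sie of λ
          { (l , l≢e , skl) → contradiction (trans (sym (update-edge s l≢e)) (full l)) (nothing≢just skl) }
      ; (no k≢i) → trans (sym (update-path s k≢i j)) (full j) }

  update-agree : ∀ {s t i e d} → (∀ j → s i j ≡ t i j) →
                 ∀ j → update s i e d i j ≡ update t i e d i j
  update-agree {s} {t} {i} {e} {d} s≗t j = case j ≟ e of λ
    { (yes refl) → trans (update-hit s i j d) (sym (update-hit t i j d))
    ; (no j≢e) → trans (update-edge s j≢e) (trans (s≗t j) (sym (update-edge t j≢e))) }

  symmetric-centre : ∀ {t i c d} → Symmetric t → Centre c → Symmetric (update t i c d)
  symmetric-centre {t} {i} {c} {d} symm ctr k j = case k ≟ i of λ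
    { (no k≢i) → trans (update-path t k≢i _) (trans (symm k j) (sym (update-path t k≢i j)))
    ; (yes refl) → case j ≟ c of λ
      { (yes refl) → cong (update t k j d k) ctr
      ; (no j≢c) → trans (update-edge t (λ oj≡c → j≢c (trans (opposite-swap oj≡c) ctr)))
                         (trans (symm k j) (sym (update-edge t j≢c))) } }

  Adj? : (j k : Fin n) → Dec (Adj j k)
  Adj? j k = (suc (toℕ j) ℕ.≟ toℕ k) ⊎-dec (suc (toℕ k) ℕ.≟ toℕ j)

  -- The neighbours of the centre mirror each other, so they never demand different directions.
  centre-direction : {f : Fin n → Maybe Dir} → (∀ j → f (opposite j) ≡ f j) →
                     ∀ {c} → Centre c → ∃ λ d → Fits f c d
  centre-direction {f = f} symm {c} ctr with any? (λ k → Adj? c k ×-dec (f k ≟ᴹ just fwd))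
  ... | yes (k , adj , fk) = fwd , λ adj' fl → case centre-neighbours ctr adj adj' of λ
    { (inj₁ refl) → just-injective (trans (sym fl) fk)
    ; (inj₂ refl) → just-injective (trans (sym fl) (trans (symm k) fk)) }
  -- Since no neighbour is `fwd`, `bwd` fits, even if no neighbour is directed.
  ... | no ¬fwd = bwd , λ
    { adj {fwd} fl → contradiction (_ , adj , fl) ¬fwd
    ; adj {bwd} fl → refl }

  centre-interior : ∀ {i} {c : Fin (len i)} → Centre c → ∀ σ → ¬ IsEnd σ c
  centre-interior {i} ctr σ = centre-not-end (5≤odd i (centre⇒odd ctr)) σ ctr

  free-centre : ∀ {t} → 2 ∣ suc (freeCentres t) →
                Σ (Fin p) λ i → ∃ λ c → Centre c × t i c ≡ nothing
  free-centre {t} odd =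
    let i , wᵢ≢0 = total-nonzero {f = λ i → total λ j → centreWeight j (t i j)}
                                 λ eq → not-both-even (subst (2 ∣_) (sym eq) (2 ∣0)) odd
        c , w≢0 = total-nonzero {f = λ j → centreWeight j (t i j)} wᵢ≢0
    in i , c , centreWeight-nonzero w≢0

  -- A centre free in `t` excludes `pair`, where `t` is full on the path; in `exact` the condition
  -- on a free centre becomes void.
  position-centre : ∀ {s t i c d} → Position s t → Centre c → t i c ≡ nothing → Fits (t i) c d →
                    Position (update s i c d) (update t i c d)
  position-centre {s} {t} {i} {c} {d} pos ctr tic fits = record
    { below = update-⊑ {s} (below pos)
    ; lawful = update-lawful (lawful pos) fits (centre-interior ctr)
    ; symmetric = symmetric-centre {t} (symmetric pos) ctr
    ; paths = λ k → case k ≟ i of λ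
      { (no k≢i) → PathInv-cong (update-path s k≢i) (update-path t k≢i) (paths pos k)
      ; (yes refl) → played (paths pos k) } }
    where
    played : PathInv (s i) (t i) → PathInv (update s i c d i) (update t i c d i)
    played (pair _ _ _ _ _ _ g≗d _ _ _) = contradiction (g≗d c) (nothing≢just tic)
    played (exact s≗t _) = exact (update-agree {s} {t} s≗t) λ c' ctr' free →
      contradiction (trans (cong (update s i c d i) (centre-unique ctr' ctr)) (update-hit s i c d))
                    (nothing≢just free)

  Pass : State → Set
  Pass s = Σ (Fin p) λ i → ∃₂ λ j d → s i j ≡ nothing × Inv (update s i j d)

  even-pred : ∀ {m} → 2 ∣ suc (suc m) → 2 ∣ m
  even-pred 2∣ssm = ∣m+n∣m⇒∣n 2∣ssm ∣-refl

  play-centre-at : ∀ {s t} → Position s t → 2 ∣ suc (freeCentres t) →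
                   ∀ i c → Centre c → t i c ≡ nothing → Pass s
  play-centre-at {s} {t} pos odd i c ctr tic with centre-direction (symmetric pos i) ctr
  ... | d , fits = i , c , d , free-below {s} {t} (below pos) tic , update t i c d ,
    position-centre pos ctr tic fits ,
    even-pred (subst (λ m → 2 ∣ suc m) (freeCentres-step {t} {i} {c} {d} ctr tic) odd)

  -- Restores the parity: an odd count is not zero, so there is a free centre to play.
  play-centre : ∀ {s t} → Position s t → 2 ∣ suc (freeCentres t) → Pass s
  play-centre {s} {t} pos odd = case free-centre {t} odd of λ
    { (i , c , ctr , tic) → play-centre-at pos odd i c ctr tic }

  -- Replies to the opponent's moves

  data Reply (s : State) : Set where
    continue : ∀ i j d → s i j ≡ nothing → Inv (update s i j d) → Reply s
    -- The opponent's own move has led to the endgame, where parity decides; no particular answer is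
    -- named.
    finish   : ∀ {d τ} → Endgame d τ s → Reply s
    enter    : ∀ i j d {d' τ} → s i j ≡ nothing → Lawful (update s i j d) →
               Endgame d' τ (update s i j d) → Reply s

  reply-pass : ∀ {s} → Pass s → Reply s
  reply-pass (i , j , d , sij , inv) = continue i j d sij inv

  -- The edge `e` was forced, so `d` is `c`. Playing `y` as well brings the path to what `t` already
  -- records, so `t` stays as it is.
  reply-pair : ∀ {s t i e d} → Position s t → 2 ∣ freeCentres t → Lawful (update s i e d) →
               ∀ {c y} → y ≢ e → s i e ≡ nothing → s i y ≡ nothing → (∀ j → t i j ≡ just c) →
               (∀ j → j ≢ e → j ≢ y → s i j ≡ just c) → Forced (s i) e c →
               Reply (update s i e d)
  reply-pair {s} {t} {i} {e} {d} pos even law {c} {y} y≢e sie siy t≗c s≗c (k , adj , sik)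
    with update-fits {s} sie (smooth law i) adj sik
  ... | refl = continue i y c s₁y (t , record
    { below = update-below {s₁} (update-below {s} (below pos) (t≗c e)) (t≗c y)
    ; lawful = lawful pos
    ; symmetric = symmetric pos
    ; paths = λ k → case k ≟ i of λ
      { (no k≢i) → PathInv-cong (λ j → trans (update-path s₁ k≢i j) (update-path s k≢i j))
                                (λ _ → refl) (paths pos k)
      ; (yes refl) → exact (λ j → trans (full j) (sym (t≗c j)))
                           (λ j _ free → contradiction (full j) (nothing≢just free)) } } , even)
    where
    s₁ : State
    s₁ = update s i e c
    s₁y : s₁ i y ≡ nothing
    s₁y = trans (update-edge s y≢e) siy
    full : ∀ j → update s₁ i y c i j ≡ just c
    full j = case j ≟ y of λ
      { (yes refl) → update-hit s₁ i j c
      ; (no j≢y) → trans (update-edge s₁ j≢y) (case j ≟ e of λ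
        { (yes refl) → update-hit s i j c
        ; (no j≢e) → trans (update-edge s j≢e) (s≗c j j≢e j≢y) }) }

  mirror : State → (i : Fin p) → Fin (len i) → Dir → State
  mirror t i e d = update (update t i e d) i (opposite e) d

  module Mirror {s t : State} {i : Fin p} {e : Fin (len i)} {d : Dir}
                (pos : Position s t) (even : 2 ∣ freeCentres t)
                (law : Lawful (update s i e d)) (sie : s i e ≡ nothing)
                (s≗t : ∀ j → s i j ≡ t i j) where

    e' : Fin (len i)
    e' = opposite e

    s₁ t₁ : State
    s₁ = update s i e d
    t₁ = update t i e d

    t₁-fits : Fits (t i) e d
    t₁-fits adj tik = update-fits {s} sie (smooth law i) adj (trans (s≗t _) tik)

    tie : t i e ≡ nothing
    tie = trans (sym (s≗t e)) sie

    module NonCentre (¬ctr : ¬ Centre e) where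

      t₂ : State
      t₂ = mirror t i e d

      t₁e' : t₁ i e' ≡ nothing
      t₁e' = trans (update-edge t ¬ctr) (trans (symmetric pos i e) tie)

      s₁e' : s₁ i e' ≡ nothing
      s₁e' = trans (update-agree {s} {t} s≗t e') t₁e'

      t₂-e' : t₂ i e' ≡ just d
      t₂-e' = update-hit t₁ i e' d

      t₂-e : t₂ i e ≡ just d
      t₂-e = trans (update-edge t₁ (λ e≡e' → ¬ctr (sym e≡e'))) (update-hit t i e d)

      t₂-else : ∀ {j} → j ≢ e → j ≢ e' → t₂ i j ≡ t i j
      t₂-else j≢e j≢e' = trans (update-edge t₁ j≢e') (update-edge t j≢e)

      t₂-path : ∀ {k} → k ≢ i → ∀ j → t₂ k j ≡ t k j
      t₂-path k≢i j = trans (update-path t₁ k≢i j) (update-path t k≢i j)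

      s₁-t₂ : ∀ {j} → j ≢ e' → s₁ i j ≡ t₂ i j
      s₁-t₂ j≢e' = trans (update-agree {s} {t} s≗t _) (sym (update-edge t₁ j≢e'))

      s₁⊑t₂ : s₁ ⊑ t₂
      s₁⊑t₂ k j eq = update-grows {t₁} t₁e' k j (update-⊑ {s} (below pos) k j eq)

      -- A neighbour of `e'` other than `e` mirrors a neighbour of `e`, so if directed it points as
      -- `d`.
      t₂-smooth : ∀ k → Smooth (t₂ k)
      t₂-smooth = update-smooth {t₁} (update-smooth {t} (smooth (lawful pos)) t₁-fits) fits
        where
        fits : Fits (t₁ i) e' d
        fits {k} adj {c} t₁k = case k ≟ e of λ
          { (yes refl) → just-injective (trans (sym t₁k) (update-hit t i k d))
          ; (no k≢e) → t₁-fits (subst (λ x → Adj x (opposite k)) (opposite-involutive e) (Adj-opposite adj))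
              (trans (symmetric pos i k) (trans (sym (update-edge t k≢e)) t₁k)) }

      t₂-symmetric : Symmetric t₂
      t₂-symmetric k j = case k ≟ i of λ
        { (no k≢i) → trans (t₂-path k≢i _) (trans (symmetric pos k j) (sym (t₂-path k≢i j)))
        ; (yes refl) → onPath j }
        where
        onPath : ∀ j → t₂ i (opposite j) ≡ t₂ i j
        onPath j = case j ≟ e of λ
          { (yes refl) → trans t₂-e' (sym t₂-e)
          ; (no j≢e) → case j ≟ e' of λ
            { (yes refl) → trans (cong (t₂ i) (opposite-involutive e)) (trans t₂-e (sym t₂-e'))
            ; (no j≢e') → trans
                (t₂-else (λ oj≡e → j≢e' (opposite-swap oj≡e))
                         (λ oj≡e' → j≢e (trans (opposite-swap oj≡e') (opposite-involutive e))))
                (trans (symmetric pos i j) (sym (t₂-else j≢e j≢e'))) } }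

      t₂-count : freeCentres t ≡ freeCentres t₂
      t₂-count = trans (freeCentres-same {t} ¬ctr)
        (freeCentres-same {t₁} λ ctr → ¬ctr (trans (sym ctr) (opposite-involutive e)))

      s₁-spare : ∀ {j} → t₂ i j ≡ nothing → s₁ i j ≡ nothing
      s₁-spare {j} = free-below {s₁} {t₂} s₁⊑t₂ {i} {j}

      -- The second premise keeps the centre from becoming the only free edge of the path.
      reply-mirror : Lawful t₂ →
        (∀ c → Centre c → t₂ i c ≡ nothing → ∃ λ j → ¬ Centre j × t₂ i j ≡ nothing) →
        Reply s₁
      reply-mirror law₂ spare = continue i e' d s₁e' (t₂ , record
        { below = update-⊑ {s₁} (update-⊑ {s} (below pos))
        ; lawful = law₂
        ; symmetric = t₂-symmetric
        ; paths = λ k → case k ≟ i of λ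
          { (no k≢i) → PathInv-cong (λ j → trans (update-path s₁ k≢i j) (update-path s k≢i j))
                                    (t₂-path k≢i) (paths pos k)
          ; (yes refl) → exact agreement spare′ } } , subst (2 ∣_) t₂-count even)
        where
        agreement : ∀ j → mirror s i e d i j ≡ t₂ i j
        agreement = update-agree {s₁} {t₁} (update-agree {s} {t} s≗t)
        spare′ : ∀ c → Centre c → mirror s i e d i c ≡ nothing →
                 ∃ λ j → j ≢ c × mirror s i e d i j ≡ nothing
        spare′ c ctr free = case spare c ctr (trans (sym (agreement c)) free) of λ
          { (j , ¬ctrⱼ , tj) → j , (λ { refl → ¬ctrⱼ ctr }) , trans (agreement j) tj }

      -- Only the mirror image of e and the centre are left: fill both virtually and play elsewhere.
      reply-convert : Lawful t₂ → ∀ c → Centre c → t₂ i c ≡ nothing →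
        ¬ (∃ λ j → ¬ Centre j × t₂ i j ≡ nothing) → Reply s₁
      reply-convert law₂ c ctr t₂c ¬spare = reply-pass (play-centre (record
        { below = λ k j eq → update-grows {t₂} t₂c k j (s₁⊑t₂ k j eq)
        ; lawful = update-lawful law₂ fits (centre-interior ctr)
        ; symmetric = symmetric-centre {t₂} t₂-symmetric ctr
        ; paths = λ k → case k ≟ i of λ
          { (no k≢i) → PathInv-cong (update-path s k≢i)
                         (λ j → trans (update-path t₂ k≢i j) (t₂-path k≢i j)) (paths pos k)
          ; (yes refl) → pair d e' c e'≢c s₁e' (s₁-spare t₂c) full
              (λ j j≢e' j≢c → trans (s₁-t₂ j≢e') (off-centre j j≢c)) forced-e' forced-c } })
        -- Counting `c` as played makes the number of free centres odd, so a centre on another path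
        -- is free.
        (subst (2 ∣_) (trans t₂-count (freeCentres-step {t₂} {d = d} ctr t₂c)) even))
        where
        e≢c : e ≢ c
        e≢c refl = ¬ctr ctr
        e'≢c : e' ≢ c
        e'≢c e'≡c = e≢c (trans (opposite-swap e'≡c) ctr)
        marked : ∀ j → j ≢ c → ∃ λ d' → t₂ i j ≡ just d'
        marked j j≢c = [ (λ m → m)
          , (λ free → contradiction (j , (λ ctrⱼ → j≢c (centre-unique ctrⱼ ctr)) , free) ¬spare)
          ]′ (marked-or-free (t₂ i j))
        off-centre : ∀ j → j ≢ c → t₂ i j ≡ just d
        off-centre = constant-off-centre (t₂-smooth i) ctr (t₂-symmetric i) marked e≢c t₂-e
        fits : Fits (t₂ i) c d
        fits {k} adj t₂k =
          just-injective (trans (sym t₂k) (off-centre k λ { refl → Adj-irrefl {j = k} adj }))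
        full : ∀ j → update t₂ i c d i j ≡ just d
        full j = case j ≟ c of λ
          { (yes refl) → update-hit t₂ i j d
          ; (no j≢c) → trans (update-edge t₂ j≢c) (off-centre j j≢c) }
        s₁-off : ∀ {j} → j ≢ e' → j ≢ c → s₁ i j ≡ just d
        s₁-off j≢e' j≢c = trans (s₁-t₂ j≢e') (off-centre _ j≢c)
        forced-e' : Forced (s₁ i) e' d
        -- Five edges give `e'` a neighbour other than `c`, and all edges but `e'` and `c` are
        -- directed `d`.
        forced-e' = case neighbour-off-centre (5≤odd i (centre⇒odd ctr)) ctr e' e'≢c of λ
          { (k , adj , k≢c) → k , adj , s₁-off (λ k≡e' → Adj-irrefl (subst (Adj e') k≡e' adj)) k≢c }
        forced-c : Forced (s₁ i) c d
        forced-c = case neighbour (2≤len i) c of λ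
          { (k , adj) → case k ≟ e' of λ
            { (no k≢e') → k , adj , s₁-off k≢e' (λ k≡c → Adj-irrefl (subst (Adj c) k≡c adj))
            -- If the neighbour found is the free `e'`, its mirror image `e` is adjacent to the
            -- centre too and has just been directed.
            ; (yes refl) → e ,
                subst (Adj c) (opposite-involutive e)
                  (subst (λ x → Adj x (opposite e')) ctr (Adj-opposite adj)) ,
                update-hit s i e d } }

      reply-lawful : Lawful t₂ → Reply s₁
      reply-lawful law₂ = case any? (λ c → Centre? c ×-dec (t₂ i c ≟ᴹ nothing)) of λ
        { (no ¬c) → reply-mirror law₂ (λ c ctr free → contradiction (c , ctr , free) ¬c)
        ; (yes (c , ctr , free)) →
            case any? (λ j → ¬? (Centre? j) ×-dec (t₂ i j ≟ᴹ nothing)) of λ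
            { (yes spare) → reply-mirror law₂ (λ _ _ _ → spare)
            ; (no ¬spare) → reply-convert law₂ c ctr free ¬spare } }

      -- `t₂` differs from the lawful `t` only at `e` and `e'`.
      ends-elsewhere : ∀ {σ c} → Constant σ c t₂ → ¬ IsEnd σ e → ¬ IsEnd σ e' → ⊥
      ends-elsewhere {σ} {c} const ¬end ¬end' = mixed (lawful pos) σ c λ k j end →
        trans (sym (update-miss t {i} {e} {d} {k} {j} λ { refl → ¬end end }))
              (trans (sym (update-miss t₁ {i} {e'} {d} {k} {j} λ { refl → ¬end' end })) (const k j end))

      other-side : ∀ {σ c} → Constant σ c t₂ → Constant (other σ) c t₂
      other-side {σ} const k j end = trans (sym (t₂-symmetric k j))
        (const k (opposite j) (subst (λ σ → IsEnd σ (opposite j)) (other-involutive σ)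
                                     (end-opposite (other σ) end)))

      every-side : ∀ {σ c} → Constant σ c t₂ → ∀ σ' → Constant σ' c t₂
      every-side {σ} const σ' with same-or-other σ σ'
      ... | inj₁ refl = const
      ... | inj₂ refl = other-side const

      played-end : ∀ {c} → Constant U c t₂ → ∃ λ σ → IsEnd σ e
      played-end const = case IsEnd? U e of λ
        { (yes end) → U , end
        ; (no ¬end) → case IsEnd? U e' of λ
          { (yes end') → V , end-opposite⁻ U end'
          ; (no ¬end') → contradiction ¬end' (ends-elsewhere {U} const ¬end) } }

      -- One of the two sides has `e` among its ends, and `e` points as `d`.
      constant-direction : ∀ {σ c} → Constant σ c t₂ → c ≡ d
      constant-direction {c = c} const with played-end (every-side const U)
      ... | σ' , end = just-injective (trans (sym (every-side const σ' i e end)) t₂-e)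

      -- All ends are committed to d, so that no cell can be completed any more.
      module Commit (const : ∀ σ → Constant σ d t₂) {σ : Side} (end : IsEnd σ e) where

        end' : IsEnd (other σ) e'
        end' = end-opposite σ end

        s₁-ends : ∀ σ → Tight σ d s₁
        s₁-ends σ k j e eq = just-injective (trans (sym (s₁⊑t₂ k j eq)) (const σ k j e))

        -- Such an end is directed in `t₂` but free in `s₁`, so its path is a `pair`, both of whose
        -- free edges are forced.
        forced-elsewhere : ∀ σ {k} → k ≢ i → ∀ j → IsEnd σ j → s₁ k j ≡ nothing → Forced (s₁ k) j d
        forced-elsewhere σ {k} k≢i j endⱼ free = go (paths pos k)
          where
          skj : s k j ≡ nothing
          skj = trans (sym (update-path s k≢i j)) free
          tkj : t k j ≡ just d
          tkj = trans (sym (t₂-path k≢i j)) (const σ k j endⱼ)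
          transport : ∀ {x} → Forced (s k) x d → Forced (s₁ k) x d
          transport (l , adj , skl) = l , adj , trans (update-path s k≢i l) skl
          go : PathInv (s k) (t k) → Forced (s₁ k) j d
          go (exact s≗t _) = contradiction (trans (s≗t j) tkj) (nothing≢just skj)
          go (pair c x y _ _ _ t≗c s≗c fx fy) with just-injective (trans (sym (t≗c j)) tkj)
          ... | refl with j ≟ x | j ≟ y
          ...   | yes refl | _ = transport fx
          ...   | no _ | yes refl = transport fy
          ...   | no j≢x | no j≢y = contradiction (s≗c j j≢x j≢y) (nothing≢just skj)

        end-of-i : ∀ {σ' j} → IsEnd σ' j → j ≡ e ⊎ j ≡ e'
        end-of-i {σ'} endⱼ with same-or-other σ σ'
        ... | inj₁ refl = inj₁ (end-unique σ endⱼ end)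
        ... | inj₂ refl = inj₂ (end-unique (other σ) endⱼ end')

        endgame₁ : Forced (s₁ i) e' d → Endgame d σ s₁
        endgame₁ forced-e' = record
          { forced = λ σ' k j endⱼ free → case k ≟ i of λ
            { (no k≢i) → forced-elsewhere σ' k≢i j endⱼ free
            ; (yes refl) → case end-of-i endⱼ of λ
              { (inj₁ refl) → contradiction (update-hit s k j d) (nothing≢just free)
              ; (inj₂ refl) → forced-e' } }
          ; tight = s₁-ends σ
          ; rest = inj₁ (s₁-ends (other σ)) }

        s₂ : State
        s₂ = update s₁ i e' (flip d)

        -- On the side of `e'` the directed ends of all other paths point as `d`. So that side is
        -- constant only if there is no other path, and then the move at `e` would have made its own
        -- side constant.
        s₂-lawful : Fits (s₁ i) e' (flip d) → Lawful s₂
        s₂-lawful fits = record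
          { smooth = update-smooth {s₁} (smooth law) fits
          ; mixed = λ σ' c → mixed₂ σ' c (same-or-other σ σ') }
          where
          mixed₂ : ∀ σ' c → σ' ≡ σ ⊎ σ' ≡ other σ → ¬ Constant σ' c s₂
          mixed₂ σ' c (inj₁ refl) =
            update-mixed {s₁} (λ endσ → ends-distinct (2≤len i) σ endσ end') (mixed law σ c)
          mixed₂ σ' c (inj₂ refl) const₂ = mixed law σ d λ k j endⱼ → case k ≟ i of λ
            { (yes refl) → trans (cong (s₁ k) (end-unique σ endⱼ end)) (update-hit s k e d)
            ; (no k≢i) → let o = endOf (other σ) k ; end-o = endOf-isEnd (other σ) k in
                contradiction
                  (trans (just-injective (trans (sym (update-hit s₁ i e' (flip d))) (const₂ i e' end')))
                         (s₁-ends (other σ) k o end-o (trans (sym (update-path s₁ k≢i o)) (const₂ k o end-o))))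
                  (flip-≢ d) }

        endgame₂ : Endgame d σ s₂
        endgame₂ = record
          { forced = λ σ' k j endⱼ free → case k ≟ i of λ
            { (no k≢i) → case forced-elsewhere σ' k≢i j endⱼ
                                (trans (sym (update-path s₁ k≢i j)) free) of λ
                { (l , adj , s₁l) → l , adj , trans (update-path s₁ k≢i l) s₁l }
            ; (yes refl) → case end-of-i endⱼ of λ
              { (inj₁ refl) → contradiction (update-grows {s₁} s₁e' k j (update-hit s k j d)) (nothing≢just free)
              ; (inj₂ refl) → contradiction (update-hit s₁ k j (flip d)) (nothing≢just free) } }
          ; tight = λ k j endⱼ eq → s₁-ends σ k j endⱼ (trans (sym (update-miss s₁ {i} {e'} {flip d} {k} {j}
              λ { refl → ends-distinct (2≤len k) σ endⱼ end' })) eq)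
          ; rest = inj₂ (i ,
              (λ j endⱼ → trans (cong (s₂ i) (end-unique (other σ) endⱼ end')) (update-hit s₁ i e' (flip d))) ,
              λ k k≢i j endⱼ eq → s₁-ends (other σ) k j endⱼ (trans (sym (update-path s₁ k≢i j)) eq)) }

        -- If the neighbour of `e'` is directed, `e'` is forced to `d` and the endgame has begun.
        -- Otherwise `e'` is the one end that nothing forces, and it is taken at once, against `d`.
        reply-commit : Reply s₁
        reply-commit with neighbour (2≤len i) e'
        ... | k , adj with marked-or-free (s₁ i k)
        ...   | inj₁ (c , s₁k) = finish (endgame₁ (k , adj , trans s₁k (cong just
                  (smooth-adj (t₂-smooth i) (swap adj) (s₁⊑t₂ i k s₁k) t₂-e'))))
        ...   | inj₂ s₁k = enter i e' (flip d) s₁e' (s₂-lawful fits) endgame₂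
          where
          fits : Fits (s₁ i) e' (flip d)
          fits adj' s₁l with end-neighbour-unique (other σ) end' adj adj'
          ... | refl = contradiction s₁l (nothing≢just s₁k)

      reply-noncentre : Reply s₁
      reply-noncentre = case all? (λ k → t₂ k (endOf U k) ≟ᴹ just d) of λ
        -- A constant side of `t₂` would make the side of `u` constant in direction `d`, which is
        -- excluded here.
        { (no ¬all) → reply-lawful (record
            { smooth = t₂-smooth
            ; mixed = λ σ c const → ¬all λ k →
                trans (every-side const U k _ (endOf-isEnd U k))
                      (cong just (constant-direction const)) })
        ; (yes all) →
            let const = λ k → at-end {U} {s = t₂} (all k)
            in case played-end const of λ
              { (σ , end) → Commit.reply-commit (every-side {U} const) end } }

    reply-centre : Centre e → Reply s₁
    reply-centre ctr = reply-pass (play-centre (position-centre pos ctr tie t₁-fits)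
      (subst (2 ∣_) (freeCentres-step {t} ctr tie) even))

    reply-exact : Reply s₁
    reply-exact = case Centre? e of λ
      { (yes ctr) → reply-centre ctr
      ; (no ¬ctr) → NonCentre.reply-noncentre ¬ctr }

  reply : ∀ {s i e d} → Inv s → s i e ≡ nothing → Lawful (update s i e d) → Reply (update s i e d)
  reply {s} {i} {e} {d} (t , pos , even) sie law = go (paths pos i)
    where
    go : PathInv (s i) (t i) → Reply (update s i e d)
    go (exact s≗t _) = Mirror.reply-exact pos even law sie s≗t
    go (pair c x y x≢y sx sy t≗c s≗c fx fy) = case e ≟ x of λ
      { (yes refl) → reply-pair pos even law (λ y≡x → x≢y (sym y≡x)) sie sy t≗c s≗c fx
      ; (no e≢x) → case e ≟ y of λ
        { (yes refl) → reply-pair pos even law x≢y sie sx t≗c (λ j j≢y j≢x → s≗c j j≢x j≢y) fy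
        ; (no e≢y) → contradiction (s≗c e e≢x e≢y) (nothing≢just sie) } }

  -- From replies to winning strategies

  CellComplete? : ∀ s → Dec (CellComplete s)
  CellComplete? s = any? λ i → any? λ i' → (suc (toℕ i) ℕ.≟ toℕ i') ×-dec
    ((all? (λ j → s i j ≟ᴹ just fwd) ×-dec all? (λ j → s i' j ≟ᴹ just bwd)) ⊎-dec
     (all? (λ j → s i j ≟ᴹ just bwd) ×-dec all? (λ j → s i' j ≟ᴹ just fwd)))

  -- An answer may itself complete a cell, which wins at once; what follows may assume that it does
  -- not.
  win-unless : ∀ {s} i j d → s i j ≡ nothing → Lawful (update s i j d) →
               (¬ CellComplete (update s i j d) → Lose (update s i j d)) → Win s
  win-unless {s} i j d sij law lost = case CellComplete? (update s i j d) of λ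
    { (yes cell) → win i j d sij (lawful⇒legal law) (inj₁ cell)
    ; (no ¬cell) → win i j d sij (lawful⇒legal law) (inj₂ (lost ¬cell)) }

  inv-lawful : ∀ {s} → Inv s → Lawful s
  inv-lawful (t , pos , _) = lawful-⊑ (below pos) (lawful pos)

  -- Induction on the number `k` of remaining rounds of two edges each; at zero the player to move
  -- has no edge left.
  lose-inv : ∀ k {s} → freeEdges s ≡ k * 2 → ¬ CellComplete s → Inv s → Lose s
  lose-inv zero {s} count _ _ = lose λ i j e sij _ →
    case trans (sym count) (freeEdges-step {s} {d = e} sij) of λ ()
  lose-inv (suc k) {s} count ¬cell inv = lose λ i e d sie legal →
    let law = legal⇒lawful legal
        count₁ = ℕₚ.suc-injective (trans (sym (freeEdges-step {s} sie)) count)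
    in no-completion (proj₁ (proj₂ inv)) ¬cell sie , answer law count₁ (reply inv sie law)
    where
    answer : ∀ {s} → Lawful s → freeEdges s ≡ suc (k * 2) → Reply s → Win s
    answer {s} _ count₁ (continue i j d sij inv′) = win-unless i j d sij (inv-lawful inv′) λ ¬cell′ →
      lose-inv k (ℕₚ.suc-injective (trans (sym (freeEdges-step {s} sij)) count₁)) ¬cell′ inv′
    answer law count₁ (finish eg) = win-endgame k eg law count₁
    answer {s} _ count₁ (enter i j d sij law′ eg) = win i j d sij (lawful⇒legal law′)
      (inj₂ (lose-endgame k eg (ℕₚ.suc-injective (trans (sym (freeEdges-step {s} sij)) count₁))))

  -- The opening position

  module Start (p≥1 : 1 ≤ p) where

    initial-lawful : Lawful initial
    initial-lawful = record
      { smooth = λ _ _ ()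
      ; mixed = λ σ d const → case const (fromℕ< p≥1) _ (endOf-isEnd σ _) of λ () }

    initial-position : Position initial initial
    initial-position = record
      { below = λ _ _ eq → eq
      ; lawful = initial-lawful
      ; symmetric = λ _ _ → refl
      -- A path with a centre has at least five edges, so its end at `u` is a second free edge.
      ; paths = λ i → exact (λ _ → refl) λ c ctr _ → endOf U i ,
          (λ { refl → centre-interior ctr U (endOf-isEnd U i) }) , refl }

    initial-count : freeEdges initial ≡ numEdges
    initial-count = total-cong {p} λ _ → total-one

    -- A path has one centre if its length is odd and none if it is even, so both counts agree
    -- modulo 2 path by path.
    initial-centres : 2 ∣ freeCentres initial + numEdges
    initial-centres = total-same-parity {p} λ i → onPath i (even-or-suc-even (len i))
      where
      onPath : ∀ i → 2 ∣ len i ⊎ 2 ∣ suc (len i) →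
               2 ∣ total {len i} (λ j → centreWeight j nothing) + len i
      onPath i (inj₁ even) = subst (λ x → 2 ∣ x + len i)
        (sym (trans (total-cong {len i} λ j → centreWeight-other (λ ctr → not-both-even even (centre⇒odd ctr)) nothing)
                    (total-zero {len i}))) even
      onPath i (inj₂ odd) = case odd⇒centre odd of λ
        { (c , ctr) → subst (λ x → 2 ∣ x + len i)
            (sym (trans (total-step c (centreWeight-centre ctr nothing)
                                      (λ j j≢c → centreWeight-other (λ ctrⱼ → j≢c (centre-unique ctrⱼ ctr)) nothing))
                        (cong suc (total-zero {len i})))) odd }

    no-initial-cell : ¬ CellComplete initial
    no-initial-cell (i , _ , _ , inj₁ (full , _)) = case full (endOf U i) of λ ()
    no-initial-cell (i , _ , _ , inj₂ (full , _)) = case full (endOf U i) of λ ()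

    second-wins : 2 ∣ numEdges → Lose initial
    second-wins even@(divides k eq) = lose-inv k (trans initial-count eq) no-initial-cell
      (initial , initial-position ,
       ∣m+n∣m⇒∣n (subst (2 ∣_) (ℕₚ.+-comm (freeCentres initial) numEdges) initial-centres) even)

    first-wins : 2 ∣ suc numEdges → Win initial
    -- Here `numEdges` is `suc (k * 2)`: after the opening centre, `k` rounds remain.
    first-wins odd@(divides (suc k) eq) = open-with (play-centre initial-position centres-odd)
      where
      centres-odd : 2 ∣ suc (freeCentres initial)
      centres-odd = [ (λ even → contradiction odd (not-both-even (∣m+n∣m⇒∣n initial-centres even)))
                    , (λ odd → odd) ]′ (even-or-suc-even (freeCentres initial))
      open-with : Pass initial → Win initial
      open-with (i , j , d , free , inv) = win-unless i j d free (inv-lawful inv) λ ¬cell →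
        lose-inv k (ℕₚ.suc-injective (trans (sym (freeEdges-step {initial} {d = d} free))
                     (trans initial-count (ℕₚ.suc-injective eq)))) ¬cell inv

theorem5 : (p : ℕ) (len : Fin p → ℕ) →
    1 ≤ p →
    ((i : Fin p) → 1 ≤ len i) →
    ((i i' : Fin p) → len i ≡ 1 → len i' ≡ 1 → i ≡ i') →
    ((i : Fin p) → Odd (len i) → 5 ≤ len i) →
    (Odd (ThetaGame.numEdges p len) → ThetaGame.Win p len (ThetaGame.initial p len)) ×
    (¬ Odd (ThetaGame.numEdges p len) → ThetaGame.Lose p len (ThetaGame.initial p len))
theorem5 p len 1≤p 1≤len _ 5≤odd =
  (λ odd → first-wins (Odd⇒suc-even numEdges odd)) ,
  (λ ¬odd → second-wins ([ (λ even → even)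
                         , (λ odd → contradiction (suc-even⇒Odd numEdges odd) ¬odd) ]′
                         (even-or-suc-even numEdges)))
  where
  5≤suc-even : ∀ i → 2 ∣ suc (len i) → 5 ≤ len i
  5≤suc-even i odd = 5≤odd i (suc-even⇒Odd (len i) odd)
  2≤len : ∀ i → 2 ≤ len i
  -- A path with a single edge has odd length and would need at least five edges.
  2≤len i = ℕₚ.≤∧≢⇒< (1≤len i) λ 1≡len →
    case subst (5 ≤_) (sym 1≡len) (5≤odd i (subst Odd 1≡len refl)) of λ { (s≤s ()) }
  open ThetaGame p len using (numEdges)
  open Strategy p len 2≤len 5≤suc-even
  open Start 1≤p
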